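{- Let $f(x)=x^2+\beta\in\mathbb{Z}[x]$ where $-\beta$ is not a perfect square. Let $a,b\in\mathbb{Q}$ with $0\le a<b$, and let $c,d\in\mathbb{N}$. For each $n\in\mathbb{N}$ let $I(n)=\{k\in\mathbb{N}: an\le k\le bn\}\cap(c\mathbb{N}+d)$ and $F_n=\prod_{k\in I(n)} f(k)$. Let $M\in\mathbb{N}$. Then there exists an effectively computable bound $B\in\mathbb{N}$ such that for all $n>B$ there exists a prime $p>Mn$ that divides $F_n$.
   Context: $\mathbb{N}$ denotes the natural numbers and $c\mathbb{N}+d=\{cm+d: m\in\mathbb{N}\}$. -}

module Defs where

open import Data.Nat as ℕ using (ℕ; zero; suc; _∸_)
open import Data.Nat.Divisibility as ℕD using ()
open import Data.Integer as ℤ using (ℤ; +_; ∣_∣)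
open import Data.Rational as ℚ using (ℚ; ↥_)
open import Data.Rational.Properties as ℚP using ()
open import Data.List using (List; upTo; filter; foldr)
open import Data.Product using (_×_)
open import Relation.Nullary using (Dec)
open import Relation.Nullary.Decidable using (_×-dec_)

ℕ→ℚ : ℕ → ℚ
ℕ→ℚ k = (+ k) ℚ./ 1

-- k ∈ cℕ + d  ⇔  ∃ m ∈ ℕ, k = c m + d   ⇔  d ≤ k and c ∣ (k ∸ d)
InProg : ℕ → ℕ → ℕ → Set
InProg c d k = (d ℕ.≤ k) × (c ℕD.∣ (k ∸ d))

InI : ℚ → ℚ → ℕ → ℕ → ℕ → ℕ → Set
InI a b c d n k =
  ((a ℚ.* ℕ→ℚ n) ℚ.≤ ℕ→ℚ k) × (ℕ→ℚ k ℚ.≤ (b ℚ.* ℕ→ℚ n)) × InProg c d k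

InI? : ∀ a b c d n k → Dec (InI a b c d n k)
InI? a b c d n k =
  ((a ℚ.* ℕ→ℚ n) ℚP.≤? ℕ→ℚ k) ×-dec (ℕ→ℚ k ℚP.≤? (b ℚ.* ℕ→ℚ n))
    ×-dec ((d ℕ.≤? k) ×-dec (c ℕD.∣? (k ∸ d)))

-- An upper bound for the search range: every k with k ≤ b n (b ≥ 0) satisfies
-- k ≤ |num b| * n, since den b ≥ 1.  Only used to make I(n) a finite list.
range : ℚ → ℕ → List ℕ
range b n = upTo (suc (∣ ↥ b ∣ ℕ.* n))

I : ℚ → ℚ → ℕ → ℕ → ℕ → List ℕ
I a b c d n = filter (InI? a b c d n) (range b n)

f : ℤ → ℕ → ℤ
f β k = (+ k) ℤ.* (+ k) ℤ.+ β

F : ℤ → ℚ → ℚ → ℕ → ℕ → ℕ → ℤ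
F β a b c d n = foldr (λ k acc → f β k ℤ.* acc) (+ 1) (I a b c d n)

{-# OPTIONS --safe #-}
-- Suppose that every prime factor of F_n is at most M n. After passing to a subprogression, compare two
-- products p-adically. The first, A, consists of S = N² ≍ n values of f (up to a constant factor), so A ≥ S^(2 S).
-- The second, Π, consists of the S² values of the form x² + β y² at differences of points of the box [0, N)²;
-- all of them are O(S), so Π ≤ O(S)^(S²). A power q of an odd prime p divides at most 2 (S / q + 1) of the
-- values of f. If k is a root of f modulo q, then the form vanishes modulo q on the two lattices x ≡ ± k y,
-- and by the Cauchy–Schwarz inequality each of them contains at least S² / q of the differences.
-- Hence A^S divides Π times a factor of size S^(O(S π(M n))), which is negligible because π(x) = o(x).
-- Comparing sizes, S^(2 S²) ≤ O(S)^(S²) S^(o(S²)), which bounds S.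
module Submission where

open import Defs
open import Data.Nat using (ℕ; zero; suc; _+_; _*_; _∸_; _^_; _⊔_; _/_; _%_; _≤_; _<_; _>_; z≤n; s≤s; z<s; s<s; s≤s⁻¹; _≟_; _<?_; NonZero; >-nonZero; ≢-nonZero⁻¹; >-nonZero⁻¹; nonTrivial⇒n>1)
open import Data.Nat.Base using (_!)
open import Data.Nat.Combinatorics using (_C_; nCk+nC[k+1]≡[n+1]C[k+1]; k![n∸k]!∣n!; nCk≡n!/k![n-k]!)
open import Data.Nat.Divisibility as ℕD using (divides; _∣?_; ∣⇒≤; ∣-trans; ∣m⇒∣m*n; ∣n⇒∣m*n; m∣m*n; n∣m*n; 1∣_; ∣1⇒≡1; *-pres-∣; *-cancelˡ-∣; *-cancelʳ-∣; *-monoʳ-∣)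
open import Data.Nat.DivMod using (m%n<n; m≡m%n+[m/n]*n; m<n*o⇒m/o<n; m/n*n≤m; m/n*n≡m)
open import Data.Nat.Induction using (<-rec)
open import Data.Nat.ListAction using (product)
open import Data.Nat.Primality using (Prime; prime?; prime⇒nonZero; prime⇒nonTrivial; euclidsLemma)
open import Data.Nat.Primality.Factorisation using (factorise)
open import Data.Nat.Properties
open import Data.Nat.Tactic.RingSolver using () renaming (solve-∀ to solveℕ)
open import Data.Integer as ℤ using (ℤ; +_; -_; ∣_∣)
open import Data.Integer.Divisibility using (_∣_)
import Data.Integer.Divisibility.Signed as ℤD
import Data.Integer.DivMod as ℤDM
import Data.Integer.Properties as ℤP
open import Data.Integer.Tactic.RingSolver using () renaming (solve-∀ to solveℤ)
open import Data.Rational as ℚ using (ℚ; 0ℚ)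
import Data.Rational.Properties as ℚP
import Data.Rational.Unnormalised as ℚᵘ
import Data.Rational.Unnormalised.Properties as ℚᵘP
open import Data.Bool using (if_then_else_)
open import Data.Empty using (⊥-elim)
open import Data.List using ([]; _∷_; foldr)
open import Data.List.Membership.Propositional using (_∈_)
open import Data.List.Membership.Propositional.Properties using (∈-filter⁺; ∈-upTo⁺)
open import Data.List.Relation.Unary.All using ([]; _∷_)
open import Data.List.Relation.Unary.Any using (here; there)
open import Data.Product using (Σ; ∃; _×_; _,_; proj₁; proj₂)
open import Data.Sum using (_⊎_; inj₁; inj₂; [_,_]′)
open import Function using (_∘_; id)
open import Relation.Binary.PropositionalEquality using (_≡_; _≢_; refl; sym; trans; cong; cong₂; subst; subst₂; module ≡-Reasoning)
open import Relation.Nullary using (¬_; Dec; yes; no; does; contradiction)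
open import Relation.Nullary.Decidable using (_×-dec_; dec-true; dec-false)

-- Comparing A with (S!)² only breaks even: both have logarithm 2 S log S to leading order. The loss
-- is that S! also contains the primes modulo which f has no root. The form x² + β y² repairs this.
-- It sees the two roots through its two lines, yet on a box of S points its values are O(S), about
-- the square root of the size of the values of f. So Π costs S² log S, against 2 S² log S for A^S.
-- Two facts carry the comparison. The exponents of p on the two lines add up in the form, even
-- beyond the power of p modulo which k is known to be a root, as long as p does not divide 2 k. And
-- the form vanishes only at the origin, because -β is not a square, so divisibility can be turned
-- into an inequality of sizes. The primes dividing 2, β or the modulus would spoil the first fact;
-- the subprogression is chosen to confine them to a constant factor of f. Every threshold is
-- explicit, which makes B computable.

infix 4 _∣ⁿ_

_∣ⁿ_ : ℕ → ℕ → Set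
_∣ⁿ_ = ℕD._∣_

-- Finite sums and products over ranges

∑ ∏ : ℕ → (ℕ → ℕ) → ℕ
∑ zero    u = 0
∑ (suc n) u = u 0 + ∑ n (u ∘ suc)
∏ zero    u = 1
∏ (suc n) u = u 0 * ∏ n (u ∘ suc)

∑-mono : ∀ n {u v} → (∀ i → i < n → u i ≤ v i) → ∑ n u ≤ ∑ n v
∑-mono zero    u≤v = z≤n
∑-mono (suc n) u≤v = +-mono-≤ (u≤v 0 z<s) (∑-mono n λ i i<n → u≤v (suc i) (s<s i<n))

∑-cong : ∀ n {u v} → (∀ i → i < n → u i ≡ v i) → ∑ n u ≡ ∑ n v
∑-cong zero    u≡v = refl
∑-cong (suc n) u≡v = cong₂ _+_ (u≡v 0 z<s) (∑-cong n λ i i<n → u≡v (suc i) (s<s i<n))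

∑-const : ∀ n c → ∑ n (λ _ → c) ≡ n * c
∑-const zero    c = refl
∑-const (suc n) c = cong (_+_ c) (∑-const n c)

+-interchange : ∀ a b c d → (a + b) + (c + d) ≡ (a + c) + (b + d)
+-interchange = solveℕ

*-interchange : ∀ a b c d → (a * b) * (c * d) ≡ (a * c) * (b * d)
*-interchange = solveℕ

∑-+ : ∀ n u v → ∑ n (λ i → u i + v i) ≡ ∑ n u + ∑ n v
∑-+ zero    u v = refl
∑-+ (suc n) u v = trans (cong (_+_ (u 0 + v 0)) (∑-+ n (u ∘ suc) (v ∘ suc)))
                        (+-interchange (u 0) (v 0) (∑ n (u ∘ suc)) (∑ n (v ∘ suc)))

∑-*ˡ : ∀ n c u → ∑ n (λ i → c * u i) ≡ c * ∑ n u
∑-*ˡ zero    c u = sym (*-zeroʳ c)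
∑-*ˡ (suc n) c u = trans (cong (_+_ (c * u 0)) (∑-*ˡ n c (u ∘ suc)))
                         (sym (*-distribˡ-+ c (u 0) (∑ n (u ∘ suc))))

∑-swap : ∀ m n (u : ℕ → ℕ → ℕ) → ∑ m (λ i → ∑ n (u i)) ≡ ∑ n (λ j → ∑ m (λ i → u i j))
∑-swap zero    n u = sym (trans (∑-const n 0) (*-zeroʳ n))
∑-swap (suc m) n u = trans (cong (_+_ (∑ n (u 0))) (∑-swap m n (u ∘ suc)))
                           (sym (∑-+ n (u 0) λ j → ∑ m (λ i → u (suc i) j)))

∑-++ : ∀ m n u → ∑ (m + n) u ≡ ∑ m u + ∑ n (λ i → u (m + i))
∑-++ zero    n u = refl
∑-++ (suc m) n u = trans (cong (_+_ (u 0)) (∑-++ m n (u ∘ suc)))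
                         (sym (+-assoc (u 0) (∑ m (u ∘ suc)) _))

∏-mono : ∀ n {u v} → (∀ i → i < n → u i ≤ v i) → ∏ n u ≤ ∏ n v
∏-mono zero    u≤v = ≤-refl
∏-mono (suc n) u≤v = *-mono-≤ (u≤v 0 z<s) (∏-mono n λ i i<n → u≤v (suc i) (s<s i<n))

∏-cong : ∀ n {u v} → (∀ i → i < n → u i ≡ v i) → ∏ n u ≡ ∏ n v
∏-cong zero    u≡v = refl
∏-cong (suc n) u≡v = cong₂ _*_ (u≡v 0 z<s) (∏-cong n λ i i<n → u≡v (suc i) (s<s i<n))

∏-const : ∀ n c → ∏ n (λ _ → c) ≡ c ^ n
∏-const zero    c = refl
∏-const (suc n) c = cong (c *_) (∏-const n c)

∏-* : ∀ n u v → ∏ n (λ i → u i * v i) ≡ ∏ n u * ∏ n v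
∏-* zero    u v = refl
∏-* (suc n) u v = trans (cong (u 0 * v 0 *_) (∏-* n (u ∘ suc) (v ∘ suc)))
                        (*-interchange (u 0) (v 0) (∏ n (u ∘ suc)) (∏ n (v ∘ suc)))

∏-++ : ∀ m n u → ∏ (m + n) u ≡ ∏ m u * ∏ n (λ i → u (m + i))
∏-++ zero    n u = sym (+-identityʳ _)
∏-++ (suc m) n u = trans (cong (u 0 *_) (∏-++ m n (u ∘ suc)))
                         (sym (*-assoc (u 0) (∏ m (u ∘ suc)) _))

∏-^ : ∀ n c u → ∏ n (λ i → c ^ u i) ≡ c ^ ∑ n u
∏-^ zero    c u = refl
∏-^ (suc n) c u = trans (cong (c ^ u 0 *_) (∏-^ n c (u ∘ suc)))
                        (sym (^-distribˡ-+-* c (u 0) (∑ n (u ∘ suc))))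

∏>0 : ∀ n {u} → (∀ i → i < n → 0 < u i) → 0 < ∏ n u
∏>0 zero    u>0 = z<s
∏>0 (suc n) u>0 = *-mono-≤ (u>0 0 z<s) (∏>0 n λ i i<n → u>0 (suc i) (s<s i<n))

∏-mono-range : ∀ {m n} u → (∀ i → i < n → 0 < u i) → m ≤ n → ∏ m u ≤ ∏ n u
∏-mono-range {m} u u>0 m≤n with m≤n⇒∃[o]m+o≡n m≤n
... | k , refl = subst (∏ m u ≤_) (sym (∏-++ m k u))
  (m≤m*n (∏ m u) _ {{>-nonZero (∏>0 k λ i i<k → u>0 (m + i) (+-monoʳ-< m i<k))}})

factor∣∏ : ∀ {n i} u → i < n → u i ∣ⁿ ∏ n u
factor∣∏ {suc n} {zero}  u i<n       = m∣m*n _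
factor∣∏ {suc n} {suc i} u (s≤s i<n) = ∣n⇒∣m*n (u 0) (factor∣∏ (u ∘ suc) i<n)

prime∣∏⇒∣factor : ∀ {p} → Prime p → ∀ n u → p ∣ⁿ ∏ n u → ∃ λ i → i < n × p ∣ⁿ u i
prime∣∏⇒∣factor pp zero    u p∣ = contradiction (∣1⇒≡1 p∣) (>⇒≢ (nonTrivial⇒n>1 _ {{prime⇒nonTrivial pp}}))
prime∣∏⇒∣factor pp (suc n) u p∣ with euclidsLemma (u 0) (∏ n (u ∘ suc)) pp p∣
... | inj₁ p∣u₀ = 0 , z<s , p∣u₀
... | inj₂ p∣∏ with prime∣∏⇒∣factor pp n (u ∘ suc) p∣∏
...   | i , i<n , p∣uᵢ = suc i , s<s i<n , p∣uᵢ

argmax : ∀ n (u : ℕ → ℕ) → 0 < n → ∃ λ i → i < n × (∀ j → j < n → u j ≤ u i)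
argmax (suc zero)    u _ = 0 , z<s , λ { zero _ → ≤-refl ; (suc _) (s≤s ()) }
argmax (suc (suc n)) u _ with argmax (suc n) (u ∘ suc) z<s
... | i , i<n , max with ≤-total (u 0) (u (suc i))
...   | inj₁ u₀≤ = suc i , s<s i<n , λ { zero _ → u₀≤ ; (suc j) (s≤s j<n) → max j j<n }
...   | inj₂ ≤u₀ = 0 , z<s , λ { zero _ → ≤-refl ; (suc j) (s≤s j<n) → ≤-trans (max j j<n) ≤u₀ }

-- Indicators

𝟙 : {P : Set} → Dec P → ℕ
𝟙 P? = if does P? then 1 else 0

𝟙-yes : {P : Set} (P? : Dec P) → P → 𝟙 P? ≡ 1
𝟙-yes P? x = cong (if_then 1 else 0) (dec-true P? x)

𝟙-no : {P : Set} (P? : Dec P) → ¬ P → 𝟙 P? ≡ 0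
𝟙-no P? ¬x = cong (if_then 1 else 0) (dec-false P? ¬x)

𝟙≤1 : {P : Set} (P? : Dec P) → 𝟙 P? ≤ 1
𝟙≤1 (yes _) = ≤-refl
𝟙≤1 (no _)  = z≤n

𝟙-mono : {P Q : Set} (P? : Dec P) (Q? : Dec Q) → (P → Q) → 𝟙 P? ≤ 𝟙 Q?
𝟙-mono (no _)  Q? imp = z≤n
𝟙-mono (yes x) Q? imp = ≤-reflexive (sym (𝟙-yes Q? (imp x)))

∑-zero : ∀ n {u} → (∀ i → i < n → u i ≡ 0) → ∑ n u ≡ 0
∑-zero n u≡0 = trans (∑-cong n u≡0) (trans (∑-const n 0) (*-zeroʳ n))

∑-δ : ∀ n {v} (u : ℕ → ℕ) → v < n → ∑ n (λ r → 𝟙 (v ≟ r) * u r) ≡ u v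
∑-δ (suc n) {zero}  u _         = trans (cong₂ _+_ (+-identityʳ (u 0)) (∑-zero n λ _ _ → refl)) (+-identityʳ (u 0))
∑-δ (suc n) {suc v} u (s≤s v<n) = ∑-δ n (u ∘ suc) v<n

∑-δ₁ : ∀ n {v} → v < n → ∑ n (λ r → 𝟙 (v ≟ r)) ≡ 1
∑-δ₁ n v<n = trans (∑-cong n λ r _ → sym (*-identityʳ _)) (∑-δ n (λ _ → 1) v<n)

-- Decreasing chains of decidable predicates

-- The count is the smaller of J and the last index up to which `Q` persists, so `Q` still holds
-- there. With `Q` i as divisibility by p^i, this turns a count of levels into a divisibility.
descending-count : ∀ {Q : ℕ → Set} (Q? : ∀ i → Dec (Q i)) → (∀ i → Q (suc i) → Q i) → Q 0 →
  ∀ J → Q (∑ J (λ j → 𝟙 (Q? (suc j))))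
descending-count Q? down q₀ zero    = q₀
descending-count {Q} Q? down q₀ (suc J) with Q? 1
... | yes q₁ = descending-count (Q? ∘ suc) (down ∘ suc) q₁ J
... | no ¬q₁ = subst Q (sym (∑-zero J λ j _ → 𝟙-no (Q? (suc (suc j))) (¬q₁ ∘ to₁ j))) q₀
  where
  to₁ : ∀ j → Q (suc (suc j)) → Q 1
  to₁ zero    q = down 1 q
  to₁ (suc j) q = to₁ j (down _ q)

descending-count-≥ : ∀ {Q : ℕ → Set} (Q? : ∀ i → Dec (Q i)) → (∀ i → Q (suc i) → Q i) →
  ∀ J {e} → e ≤ J → Q e → e ≤ ∑ J (λ j → 𝟙 (Q? (suc j)))
descending-count-≥ Q? down J       z≤n       q = z≤n
descending-count-≥ {Q} Q? down (suc J) (s≤s {e} e≤J) q with Q? 1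
... | yes q₁ = s≤s (descending-count-≥ (Q? ∘ suc) (down ∘ suc) J e≤J q)
... | no ¬q₁ = contradiction (to₁ e q) ¬q₁
  where
  to₁ : ∀ j → Q (suc j) → Q 1
  to₁ zero    q = q
  to₁ (suc j) q = to₁ j (down _ q)

-- p-adic valuations

n<p^n : ∀ {p} → 1 < p → ∀ n → n < p ^ n
n<p^n     1<p zero    = z<s
n<p^n {p} 1<p (suc n) = begin-strict
  suc n       ≤⟨ n<p^n 1<p n ⟩
  p ^ n       <⟨ m<m*n (p ^ n) p {{>-nonZero (≤-<-trans z≤n (n<p^n 1<p n))}} 1<p ⟩
  p ^ n * p   ≡⟨ *-comm (p ^ n) p ⟩
  p * p ^ n   ∎
  where open ≤-Reasoning

prime>1 : ∀ {p} → Prime p → 1 < p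
prime>1 pp = nonTrivial⇒n>1 _ {{prime⇒nonTrivial pp}}

prime∤1 : ∀ {p} → Prime p → ¬ (p ∣ⁿ 1)
prime∤1 pp p∣1 = contradiction (∣1⇒≡1 p∣1) (>⇒≢ (prime>1 pp))

p^>0 : ∀ {p} → Prime p → ∀ n → 0 < p ^ n
p^>0 pp n = ≤-<-trans z≤n (n<p^n (prime>1 pp) n)

^-∣ : ∀ p {m n} → m ≤ n → p ^ m ∣ⁿ p ^ n
^-∣ p {m} m≤n with m≤n⇒∃[o]m+o≡n m≤n
... | k , refl = subst (p ^ m ∣ⁿ_) (sym (^-distribˡ-+-* p m k)) (m∣m*n (p ^ k))

-- Counted level by level, so that sums of valuations can be compared with sums over powers of p.
-- For positive n and prime p the cut-off at n levels is harmless, since n < p^n.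
ν : ℕ → ℕ → ℕ
ν p n = ∑ n (λ j → 𝟙 (p ^ suc j ∣? n))

p^suc∣⇒p^∣ : ∀ p {n} i → p ^ suc i ∣ⁿ n → p ^ i ∣ⁿ n
p^suc∣⇒p^∣ p i = ∣-trans (n∣m*n p)

p^ν∣n : ∀ p n → p ^ ν p n ∣ⁿ n
p^ν∣n p n = descending-count (λ i → p ^ i ∣? n) (p^suc∣⇒p^∣ p) (1∣ n) n

p^e∣n⇒e≤ν : ∀ {p n e} → Prime p → 0 < n → p ^ e ∣ⁿ n → e ≤ ν p n
p^e∣n⇒e≤ν {p} {n} {e} pp n>0 p^e∣n =
  descending-count-≥ (λ i → p ^ i ∣? n) (p^suc∣⇒p^∣ p) n
    (≤-trans (<⇒≤ (n<p^n (prime>1 pp) e)) (∣⇒≤ {{>-nonZero n>0}} p^e∣n)) p^e∣n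

p∣n⇒ν>0 : ∀ {p n} → Prime p → 0 < n → p ∣ⁿ n → 0 < ν p n
p∣n⇒ν>0 {p} pp n>0 p∣n = p^e∣n⇒e≤ν pp n>0 (subst (_∣ⁿ _) (sym (*-identityʳ p)) p∣n)

ν>0⇒p∣n : ∀ {p n} → 0 < ν p n → p ∣ⁿ n
ν>0⇒p∣n {p} {n} ν>0 = subst (_∣ⁿ n) (*-identityʳ p) (∣-trans (^-∣ p ν>0) (p^ν∣n p n))

ν-cofactor : ∀ {p n} → Prime p → 0 < n → ∃ λ u → n ≡ u * p ^ ν p n × ¬ (p ∣ⁿ u)
ν-cofactor {p} {n} pp n>0 with p^ν∣n p n
... | divides u n≡ = u , n≡ , λ p∣u → <⇒≱ (n<1+n _)
  (p^e∣n⇒e≤ν pp n>0 (subst (p ^ suc (ν p n) ∣ⁿ_) (sym n≡) (*-pres-∣ p∣u (ℕD.∣-refl {p ^ ν p n}))))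

m*n>0 : ∀ {m n} → 0 < m → 0 < n → 0 < m * n
m*n>0 m>0 n>0 = *-mono-≤ m>0 n>0

-- A larger power of p in the product would, after cancellation, leave p dividing the product of two
-- cofactors prime to p.
ν-* : ∀ {p a b} → Prime p → 0 < a → 0 < b → ν p (a * b) ≡ ν p a + ν p b
ν-* {p} {a} {b} pp a>0 b>0 = ≤-antisym (≮⇒≥ upper) lower
  where
  lower : ν p a + ν p b ≤ ν p (a * b)
  lower = p^e∣n⇒e≤ν pp (m*n>0 a>0 b>0) (subst (_∣ⁿ a * b) (sym (^-distribˡ-+-* p (ν p a) (ν p b)))
            (*-pres-∣ (p^ν∣n p a) (p^ν∣n p b)))
  upper : ¬ (ν p a + ν p b < ν p (a * b))
  upper lt with ν-cofactor pp a>0 | ν-cofactor pp b>0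
  ... | u , a≡ , p∤u | v , b≡ , p∤v = [ p∤u , p∤v ]′ (euclidsLemma u v pp p∣uv)
    where
    E = p ^ (ν p a + ν p b)
    ab≡ : a * b ≡ u * v * E
    ab≡ = trans (cong₂ _*_ a≡ b≡) (trans (*-interchange u (p ^ ν p a) v (p ^ ν p b))
            (cong (_*_ (u * v)) (sym (^-distribˡ-+-* p (ν p a) (ν p b)))))
    p∣uv : p ∣ⁿ u * v
    p∣uv = *-cancelʳ-∣ E {{>-nonZero (p^>0 pp (ν p a + ν p b))}}
             (subst (p * E ∣ⁿ_) ab≡ (∣-trans (^-∣ p lt) (p^ν∣n p (a * b))))

ν-1 : ∀ {p} → Prime p → ν p 1 ≡ 0
ν-1 {p} pp = n≤0⇒n≡0 (≮⇒≥ λ ν>0 → prime∤1 pp (ν>0⇒p∣n ν>0))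

ν-∏ : ∀ {p} → Prime p → ∀ n {u} → (∀ i → i < n → 0 < u i) → ν p (∏ n u) ≡ ∑ n (ν p ∘ u)
ν-∏ pp zero    u>0 = ν-1 pp
ν-∏ {p} pp (suc n) {u} u>0 = trans (ν-* pp (u>0 0 z<s) (∏>0 n λ i i<n → u>0 (suc i) (s<s i<n)))
  (cong (_+_ (ν p (u 0))) (ν-∏ pp n λ i i<n → u>0 (suc i) (s<s i<n)))

ν-^ : ∀ {p a} → Prime p → 0 < a → ∀ n → ν p (a ^ n) ≡ n * ν p a
ν-^ {p} {a} pp a>0 n = begin
  ν p (a ^ n)            ≡⟨ cong (ν p) (∏-const n a) ⟨
  ν p (∏ n (λ _ → a))    ≡⟨ ν-∏ pp n (λ _ _ → a>0) ⟩
  ∑ n (λ _ → ν p a)      ≡⟨ ∑-const n (ν p a) ⟩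
  n * ν p a              ∎
  where open ≡-Reasoning

∃-prime-divisor : ∀ n → 1 < n → ∃ λ p → Prime p × p ∣ⁿ n
∃-prime-divisor n 1<n with factorise n {{>-nonZero (<-trans z<s 1<n)}}
... | record { factors = []     ; isFactorisation = n≡ } = contradiction n≡ (>⇒≢ 1<n)
... | record { factors = p ∷ ps ; isFactorisation = n≡ ; factorsPrime = pp ∷ _ } =
  p , pp , subst (p ∣ⁿ_) (sym n≡) (m∣m*n (product ps))

-- Strong induction on x: a prime factor of x also divides y, and cancelling it from both lowers
-- both valuations alike.
∣-from-ν : ∀ x y → 0 < x → 0 < y → (∀ p → Prime p → ν p x ≤ ν p y) → x ∣ⁿ y
∣-from-ν = <-rec _ step
  where
  step : ∀ x → (∀ {x'} → x' < x → ∀ y → 0 < x' → 0 < y → (∀ p → Prime p → ν p x' ≤ ν p y) → x' ∣ⁿ y) →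
         ∀ y → 0 < x → 0 < y → (∀ p → Prime p → ν p x ≤ ν p y) → x ∣ⁿ y
  step (suc zero)    rec y x>0 y>0 ν≤ = 1∣ y
  step x@(suc (suc _)) rec y x>0 y>0 ν≤ with ∃-prime-divisor x (s≤s z<s)
  ... | p , pp , p∣x with p∣x | ν>0⇒p∣n {p} {y} (≤-trans (p∣n⇒ν>0 pp x>0 p∣x) (ν≤ p pp))
  ... | divides x' x≡ | divides y' y≡ = subst₂ _∣ⁿ_ (sym x≡) (sym y≡)
        (ℕD.*-monoˡ-∣ p (rec x'<x y' x'>0 y'>0 ν'≤))
    where
    positive : ∀ {z z'} → 0 < z → z ≡ z' * p → 0 < z'
    positive {z' = zero}  z>0 z≡ = contradiction z≡ (>⇒≢ z>0)
    positive {z' = suc _} z>0 z≡ = z<s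
    x'>0 : 0 < x'
    x'>0 = positive x>0 x≡
    y'>0 : 0 < y'
    y'>0 = positive y>0 y≡
    x'<x : x' < x
    x'<x = subst (x' <_) (sym x≡) (m<m*n x' p {{>-nonZero x'>0}} (prime>1 pp))
    ν'≤ : ∀ r → Prime r → ν r x' ≤ ν r y'
    ν'≤ r pr = +-cancelʳ-≤ (ν r p) (ν r x') (ν r y') (subst₂ _≤_
      (trans (cong (ν r) x≡) (ν-* pr x'>0 (<⇒≤ (prime>1 pp))))
      (trans (cong (ν r) y≡) (ν-* pr y'>0 (<⇒≤ (prime>1 pp))))
      (ν≤ r pr))

-- Serves to show that a rational square root of `- β` is an integer.
m²∣n²⇒m∣n : ∀ m n → 0 < m → 0 < n → m * m ∣ⁿ n * n → m ∣ⁿ n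
m²∣n²⇒m∣n m n m>0 n>0 (divides t n²≡) = ∣-from-ν m n m>0 n>0 λ p pp → *-cancelˡ-≤ 2 (begin
    2 * ν p m              ≡⟨ double (ν p m) ⟩
    ν p m + ν p m          ≡⟨ ν-* pp m>0 m>0 ⟨
    ν p (m * m)            ≤⟨ p^e∣n⇒e≤ν pp (m*n>0 n>0 n>0) (∣-trans (p^ν∣n p (m * m)) (divides t n²≡)) ⟩
    ν p (n * n)            ≡⟨ ν-* pp n>0 n>0 ⟩
    ν p n + ν p n          ≡⟨ double (ν p n) ⟨
    2 * ν p n              ∎)
  where
  open ≤-Reasoning
  double : ∀ a → 2 * a ≡ a + a
  double = solveℕ

-- Chebyshev's bound for the number of primes

primePart : ℕ → ℕ
primePart i = i ^ 𝟙 (prime? i)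

primePart>0 : ∀ i → 0 < primePart i
primePart>0 i with prime? i
... | yes pp = subst (0 <_) (sym (*-identityʳ i)) (<⇒≤ (prime>1 pp))
... | no _   = z<s

-- Once c is divided by the first prime a, the later primes still divide the quotient: they exceed
-- a, so they cannot divide a.
primes-∏∣ : ∀ n a c → (∀ p → Prime p → a ≤ p → p < a + n → p ∣ⁿ c) → ∏ n (λ i → primePart (a + i)) ∣ⁿ c
primes-∏∣ zero    a c ps∣c = 1∣ c
primes-∏∣ (suc n) a c ps∣c = subst (_∣ⁿ c) reindex (head (prime? a))
  where
  reindex : primePart a * ∏ n (λ i → primePart (suc a + i)) ≡ ∏ (suc n) (λ i → primePart (a + i))
  reindex = cong₂ _*_ (cong primePart (sym (+-identityʳ a))) (∏-cong n λ i _ → cong primePart (sym (+-suc a i)))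
  rest = ∏ n (λ i → primePart (suc a + i))
  head : (d : Dec (Prime a)) → a ^ 𝟙 d * rest ∣ⁿ c
  head (no _) = subst (_∣ⁿ c) (sym (+-identityʳ _)) (primes-∏∣ n (suc a) c λ p pp a<p p<a+n →
    ps∣c p pp (<⇒≤ a<p) (subst (p <_) (sym (+-suc a n)) p<a+n))
  head (yes pa) with ps∣c a pa ≤-refl (m<m+n a z<s)
  ... | divides t c≡ = subst₂ _∣ⁿ_ (cong (_* rest) (sym (*-identityʳ a))) (trans (*-comm a t) (sym c≡))
        (*-monoʳ-∣ a (primes-∏∣ n (suc a) t λ p pp a<p p<a+n →
          [ id , (λ p∣a → ⊥-elim (p≢a pp a<p p∣a)) ]′ (euclidsLemma t a pp
            (subst (p ∣ⁿ_) c≡ (ps∣c p pp (<⇒≤ a<p) (subst (p <_) (sym (+-suc a n)) p<a+n))))))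
    where
    p≢a : ∀ {p} → Prime p → a < p → ¬ (p ∣ⁿ a)
    p≢a pp a<p p∣a = <⇒≱ a<p (∣⇒≤ {{prime⇒nonZero pa}} p∣a)

prime∣n!⇒≤n : ∀ {p} → Prime p → ∀ n → p ∣ⁿ n ! → p ≤ n
prime∣n!⇒≤n pp zero    p∣1 = contradiction p∣1 (prime∤1 pp)
prime∣n!⇒≤n pp (suc n) p∣  = [ ∣⇒≤ , (λ p∣n! → m≤n⇒m≤1+n (prime∣n!⇒≤n pp n p∣n!)) ]′ (euclidsLemma (suc n) (n !) pp p∣)

nCk≤2^n : ∀ n k → n C k ≤ 2 ^ n
nCk≤2^n zero    zero    = ≤-refl
nCk≤2^n zero    (suc k) = z≤n
nCk≤2^n (suc n) zero    = m^n>0 2 (suc n)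
nCk≤2^n (suc n) (suc k) = begin
  suc n C suc k          ≡⟨ nCk+nC[k+1]≡[n+1]C[k+1] n k ⟨
  n C k + n C suc k      ≤⟨ +-mono-≤ (nCk≤2^n n k) (nCk≤2^n n (suc k)) ⟩
  2 ^ n + 2 ^ n          ≡⟨ cong (_+_ (2 ^ n)) (+-identityʳ (2 ^ n)) ⟨
  2 ^ suc n              ∎
  where open ≤-Reasoning

nCk*k!*[n∸k]!≡n! : ∀ {n k} → k ≤ n → (n C k) * (k ! * (n ∸ k) !) ≡ n !
nCk*k!*[n∸k]!≡n! {n} {k} k≤n = trans (cong (_* (k ! * (n ∸ k) !)) (nCk≡n!/k![n-k]! k≤n))
                                     (m/n*n≡m (k![n∸k]!∣n! k≤n))
  where instance
    _ : NonZero (k ! * (n ∸ k) !)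
    _ = m*n≢0 (k !) ((n ∸ k) !) {{k !≢0}} {{(n ∸ k) !≢0}}

-- Such a prime occurs in (2m)! but in neither factor m! of the denominator.
prime∣central-binomial : ∀ m p → Prime p → suc m ≤ p → p < suc m + m → p ∣ⁿ (m + m) C m
prime∣central-binomial m p pp m<p p≤2m =
  [ id , (λ p∣ → ⊥-elim (p∤m!m! p∣)) ]′ (euclidsLemma ((m + m) C m) (m ! * (m + m ∸ m) !) pp p∣C*m!m!)
  where
  p∣2m! : p ∣ⁿ (m + m) !
  p∣2m! = ∣-trans (p∣p! p (≤-<-trans z≤n m<p)) (ℕD.m≤n⇒m!∣n! (s≤s⁻¹ p≤2m))
    where
    p∣p! : ∀ q → 0 < q → q ∣ⁿ q !
    p∣p! (suc q) _ = m∣m*n (q !)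
  p∣C*m!m! : p ∣ⁿ ((m + m) C m) * (m ! * (m + m ∸ m) !)
  p∣C*m!m! = subst (p ∣ⁿ_) (sym (nCk*k!*[n∸k]!≡n! (m≤m+n m m))) p∣2m!
  p∤m!m! : ¬ (p ∣ⁿ m ! * (m + m ∸ m) !)
  p∤m!m! p∣ = [ (λ d → <⇒≱ m<p (prime∣n!⇒≤n pp m d))
              , (λ d → <⇒≱ m<p (subst (p ≤_) (m+n∸n≡m m m) (prime∣n!⇒≤n pp (m + m ∸ m) d))) ]′
              (euclidsLemma (m !) ((m + m ∸ m) !) pp p∣)

-- Erdős's induction from m to 2m, run along the powers of two only: the primes in (m, 2m] multiply
-- to a divisor of the central binomial coefficient, which is at most 4^m.
primorial-2^ : ∀ i → ∏ (suc (2 ^ i)) primePart ≤ 2 ^ (2 * 2 ^ i)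
primorial-2^ zero    = s≤s z≤n
primorial-2^ (suc i) = begin
  ∏ (suc (2 * m)) primePart                               ≡⟨ cong (λ k → ∏ (suc (m + k)) primePart) (+-identityʳ m) ⟩
  ∏ (suc m + m) primePart                                 ≡⟨ ∏-++ (suc m) m primePart ⟩
  ∏ (suc m) primePart * ∏ m (λ j → primePart (suc m + j)) ≤⟨ *-mono-≤ (primorial-2^ i) (≤-trans ∏≤C (nCk≤2^n (m + m) m)) ⟩
  2 ^ (2 * m) * 2 ^ (m + m)                               ≡⟨ ^-distribˡ-+-* 2 (2 * m) (m + m) ⟨
  2 ^ (2 * m + (m + m))                                   ≡⟨ cong (2 ^_) (arith m) ⟩
  2 ^ (2 * (2 * m))                                       ∎
  where
  open ≤-Reasoning
  m = 2 ^ i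
  arith : ∀ m → 2 * m + (m + m) ≡ 2 * (2 * m)
  arith = solveℕ
  C>0 : 0 < (m + m) C m
  C>0 = n≢0⇒n>0 λ C≡0 → contradiction
    (trans (sym (nCk*k!*[n∸k]!≡n! (m≤m+n m m))) (cong (_* (m ! * (m + m ∸ m) !)) C≡0))
    (≢-nonZero⁻¹ ((m + m) !) {{(m + m) !≢0}})
  ∏≤C : ∏ m (λ j → primePart (suc m + j)) ≤ (m + m) C m
  ∏≤C = ∣⇒≤ {{>-nonZero C>0}} (primes-∏∣ m (suc m) ((m + m) C m) (prime∣central-binomial m))

∃2^-≥ : ∀ n → ∃ λ i → n ≤ 2 ^ i × 2 ^ i ≤ 2 * n + 1
∃2^-≥ zero = 0 , z≤n , ≤-refl
∃2^-≥ (suc n) with ∃2^-≥ n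
... | i , n≤ , ≤2n+1 with suc n ≤? 2 ^ i
...   | yes n<2^i = i , n<2^i , ≤-trans ≤2n+1 (+-monoˡ-≤ 1 (*-monoʳ-≤ 2 (n≤1+n n)))
...   | no  n≮2^i = suc i
  , ≤-trans (+-mono-≤ (m^n>0 2 i) n≤) (≤-reflexive (cong (_+_ (2 ^ i)) (sym (+-identityʳ (2 ^ i)))))
  , ≤-trans (*-monoʳ-≤ 2 (s≤s⁻¹ (≰⇒> n≮2^i))) (≤-trans (*-monoʳ-≤ 2 (n≤1+n n)) (m≤m+n (2 * suc n) 1))

primeCount : ℕ → ℕ
primeCount n = ∑ (suc n) (λ i → 𝟙 (prime? i))

∑-below : ∀ n k → ∑ n (λ i → 𝟙 (i <? k)) ≤ k
∑-below n       zero    = ≤-reflexive (∑-zero n λ _ _ → refl)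
∑-below zero    (suc k) = z≤n
∑-below (suc n) (suc k) = s≤s (∑-below n k)

2^-cancel-≤ : ∀ m n → 2 ^ m ≤ 2 ^ n → m ≤ n
2^-cancel-≤ m n 2^m≤2^n = ≮⇒≥ λ n<m → <⇒≱ (^-monoʳ-< 2 (s≤s z<s) n<m) 2^m≤2^n

-- Every prime is at least 2 ^ κ, except at most 2 ^ κ of them.
primeCount-bound : ∀ κ n → κ * primeCount n ≤ 2 * (2 * n + 1) + κ * 2 ^ κ
primeCount-bound κ n with ∃2^-≥ n
... | i , n≤2^i , 2^i≤ = 2^-cancel-≤ _ _ (begin
  2 ^ (κ * primeCount n)                                  ≡⟨ ^-*-assoc 2 κ (primeCount n) ⟨
  Y ^ primeCount n                                        ≡⟨ ∏-^ (suc n) Y (λ i → 𝟙 (prime? i)) ⟨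
  -- A prime i ≥ Y pays for its factor Y itself; a smaller one is paid by the second product, which
  -- has at most Y nontrivial factors.
  ∏ (suc n) (λ i → Y ^ 𝟙 (prime? i))                      ≤⟨ ∏-mono (suc n) (λ i _ → pointwise i) ⟩
  ∏ (suc n) (λ i → primePart i * Y ^ 𝟙 (i <? Y))          ≡⟨ ∏-* (suc n) primePart (λ i → Y ^ 𝟙 (i <? Y)) ⟩
  ∏ (suc n) primePart * ∏ (suc n) (λ i → Y ^ 𝟙 (i <? Y))  ≤⟨ *-mono-≤ primorial≤ few ⟩
  2 ^ (2 * (2 * n + 1)) * 2 ^ (κ * Y)                     ≡⟨ ^-distribˡ-+-* 2 (2 * (2 * n + 1)) (κ * Y) ⟨
  2 ^ (2 * (2 * n + 1) + κ * Y)                           ∎)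
  where
  open ≤-Reasoning
  Y = 2 ^ κ
  instance
    _ : NonZero Y
    _ = m^n≢0 2 κ
  pointwise : ∀ i → Y ^ 𝟙 (prime? i) ≤ primePart i * Y ^ 𝟙 (i <? Y)
  pointwise i with prime? i
  ... | no  _ = subst (1 ≤_) (sym (+-identityʳ _)) (m^n>0 Y (𝟙 (i <? Y)))
  ... | yes pp = subst₂ _≤_ (sym (*-identityʳ Y)) (cong (_* Y ^ 𝟙 (i <? Y)) (sym (*-identityʳ i)))
    ([ (λ i<Y → subst (λ e → Y ≤ i * Y ^ e) (sym (𝟙-yes (i <? Y) i<Y))
                  (subst (λ z → Y ≤ i * z) (sym (*-identityʳ Y)) (m≤n*m Y i {{prime⇒nonZero pp}})))
     , (λ Y≤i → ≤-trans Y≤i (m≤m*n i _ {{m^n≢0 Y (𝟙 (i <? Y))}})) ]′ (<-≤-connex i Y))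
  primorial≤ : ∏ (suc n) primePart ≤ 2 ^ (2 * (2 * n + 1))
  primorial≤ = ≤-trans (∏-mono-range primePart (λ i _ → primePart>0 i) (s≤s n≤2^i))
    (≤-trans (primorial-2^ i) (^-monoʳ-≤ 2 (*-monoʳ-≤ 2 2^i≤)))
  few : ∏ (suc n) (λ i → Y ^ 𝟙 (i <? Y)) ≤ 2 ^ (κ * Y)
  few = ≤-trans (≤-reflexive (∏-^ (suc n) Y (λ i → 𝟙 (i <? Y))))
    (≤-trans (^-monoʳ-≤ Y (∑-below (suc n) Y)) (≤-reflexive (^-*-assoc 2 κ Y)))

-- The form of π(x) = o(x) that is used; 24 is the density that `growth` can afford.
primeCount-sparse : ∀ Q → ∃ λ S₀ → ∀ S n → S₀ ≤ S → n ≤ Q * S → 24 * primeCount n ≤ S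
primeCount-sparse Q = S₀ , λ S n S₀≤S n≤QS → *-cancelˡ-≤ κ (begin
    κ * (24 * primeCount n)                    ≡⟨ arith₁ κ (primeCount n) ⟩
    24 * (κ * primeCount n)                    ≤⟨ *-monoʳ-≤ 24 (primeCount-bound κ n) ⟩
    24 * (2 * (2 * n + 1) + κ * 2 ^ κ)         ≡⟨ arith₂ n (κ * 2 ^ κ) ⟩
    96 * n + S₀                                ≤⟨ +-mono-≤ (*-monoʳ-≤ 96 n≤QS) S₀≤S ⟩
    96 * (Q * S) + S                           ≤⟨ m≤m+n _ (95 * S) ⟩
    96 * (Q * S) + S + 95 * S                  ≡⟨ arith₃ Q S ⟩
    κ * S                                      ∎)
  where
  open ≤-Reasoning
  -- The main term of `primeCount-bound` is 4 n, so 24 times it is 96 n ≤ 96 Q S; the further 96 S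
  -- in κ S absorbs the constant `S₀`.
  κ = 96 * suc Q
  S₀ = 48 + 24 * (κ * 2 ^ κ)
  arith₁ : ∀ k x → k * (24 * x) ≡ 24 * (k * x)
  arith₁ = solveℕ
  arith₂ : ∀ n x → 24 * (2 * (2 * n + 1) + x) ≡ 96 * n + (48 + 24 * x)
  arith₂ = solveℕ
  arith₃ : ∀ Q S → 96 * (Q * S) + S + 95 * S ≡ (96 * suc Q) * S
  arith₃ = solveℕ

-- Counting residues

at-most-one : ∀ n {P : ℕ → Set} (P? : ∀ i → Dec (P i)) →
  (∀ {i j} → i < n → j < n → P i → P j → i ≡ j) → ∑ n (λ i → 𝟙 (P? i)) ≤ 1
at-most-one zero    P? unique = z≤n
at-most-one (suc n) P? unique with P? 0
... | no _   = at-most-one n (P? ∘ suc) λ i<n j<n Pi Pj → suc-injective (unique (s<s i<n) (s<s j<n) Pi Pj)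
... | yes P₀ = s≤s (≤-reflexive (∑-zero n λ i i<n → 𝟙-no (P? (suc i)) λ Pi → 0≢1+n (unique z<s (s<s i<n) P₀ Pi)))

-- Every block of q consecutive indices contains at most one solution, so blocks are peeled off; the
-- last, possibly incomplete one costs the summand q.
congruent-count : ∀ q .{{_ : NonZero q}} S {P : ℕ → Set} (P? : ∀ i → Dec (P i)) →
  (∀ {i j} → i < S → j < S → P i → P j → i ≤ j → q ∣ⁿ j ∸ i) →
  q * ∑ S (λ i → 𝟙 (P? i)) ≤ S + q
congruent-count q = <-rec _ step
  where
  open ≤-Reasoning
  Claim : ℕ → Set₁
  Claim S = {P : ℕ → Set} (P? : ∀ i → Dec (P i)) →
    (∀ {i j} → i < S → j < S → P i → P j → i ≤ j → q ∣ⁿ j ∸ i) →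
    q * ∑ S (λ i → 𝟙 (P? i)) ≤ S + q
  short : ∀ n {P : ℕ → Set} → n ≤ q → (∀ {i j} → i < n → j < n → P i → P j → i ≤ j → q ∣ⁿ j ∸ i) →
    ∀ {i j} → i < n → j < n → P i → P j → i ≤ j → i ≡ j
  short n n≤q cong-mod {i} {j} i<n j<n Pi Pj i≤j with j ∸ i in eq | cong-mod i<n j<n Pi Pj i≤j
  ... | zero  | _   = ≤-antisym i≤j (m∸n≡0⇒m≤n eq)
  ... | suc k | q∣k = contradiction (≤-trans n≤q (∣⇒≤ q∣k))
        (<⇒≱ (≤-<-trans (≤-reflexive (sym eq)) (≤-<-trans (m∸n≤m j i) j<n)))
  first : ∀ n {P : ℕ → Set} (P? : ∀ i → Dec (P i)) → n ≤ q →
    (∀ {i j} → i < n → j < n → P i → P j → i ≤ j → q ∣ⁿ j ∸ i) → ∑ n (λ i → 𝟙 (P? i)) ≤ 1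
  first n {P} P? n≤q cong-mod = at-most-one n P? λ {i} {j} i<n j<n Pi Pj →
    [ short n {P} n≤q cong-mod i<n j<n Pi Pj , (λ j≤i → sym (short n {P} n≤q cong-mod j<n i<n Pj Pi j≤i)) ]′ (≤-total i j)
  step : ∀ S → (∀ {S'} → S' < S → Claim S') → Claim S
  step S rec P? cong-mod with S ≤? q
  ... | yes S≤q = begin
        q * ∑ S (λ i → 𝟙 (P? i))  ≤⟨ *-monoʳ-≤ q (first S P? S≤q cong-mod) ⟩
        q * 1                     ≡⟨ *-identityʳ q ⟩
        q                         ≤⟨ m≤n+m q S ⟩
        S + q                     ∎
  ... | no S≰q with m≤n⇒∃[o]m+o≡n (<⇒≤ (≰⇒> S≰q))
  ...   | S' , refl = begin
        q * ∑ (q + S') (λ i → 𝟙 (P? i))                               ≡⟨ cong (q *_) (∑-++ q S' _) ⟩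
        q * (∑ q (λ i → 𝟙 (P? i)) + ∑ S' (λ i → 𝟙 (P? (q + i))))      ≡⟨ *-distribˡ-+ q (∑ q (λ i → 𝟙 (P? i))) _ ⟩
        q * ∑ q (λ i → 𝟙 (P? i)) + q * ∑ S' (λ i → 𝟙 (P? (q + i)))    ≤⟨ +-mono-≤
          (*-monoʳ-≤ q (first q P? ≤-refl λ i<q j<q → cong-mod (≤-trans i<q (m≤m+n q S')) (≤-trans j<q (m≤m+n q S'))))
          (rec (m<n+m S' (>-nonZero⁻¹ q)) (λ i → P? (q + i)) λ {i} {j} i<S' j<S' Pi Pj i≤j →
            subst (q ∣ⁿ_) ([m+n]∸[m+o]≡n∸o q j i)
              (cong-mod (+-monoʳ-< q i<S') (+-monoʳ-< q j<S') Pi Pj (+-monoʳ-≤ q i≤j))) ⟩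
        q * 1 + (S' + q)                                              ≡⟨ cong (_+ (S' + q)) (*-identityʳ q) ⟩
        q + (S' + q)                                                  ≡⟨ +-assoc q S' q ⟨
        q + S' + q                                                    ∎

-- Pairs of indices in a common residue class

2ab≤a²+b² : ∀ a b → 2 * a * b ≤ a * a + b * b
2ab≤a²+b² a b = [ ordered a b , (λ b≤a → subst₂ _≤_ (comm b a) (+-comm (b * b) (a * a)) (ordered b a b≤a)) ]′ (≤-total a b)
  where
  comm : ∀ a b → 2 * a * b ≡ 2 * b * a
  comm = solveℕ
  expand : ∀ a k → a * a + (a + k) * (a + k) ≡ 2 * a * (a + k) + k * k
  expand = solveℕ
  ordered : ∀ a b → a ≤ b → 2 * a * b ≤ a * a + b * b
  ordered a b a≤b with m≤n⇒∃[o]m+o≡n a≤b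
  ... | k , refl = ≤-trans (m≤m+n _ (k * k)) (≤-reflexive (sym (expand a k)))

cauchy-schwarz : ∀ n u → ∑ n u * ∑ n u ≤ n * ∑ n (λ i → u i * u i)
cauchy-schwarz zero    u = z≤n
cauchy-schwarz (suc n) u = begin
  (a + U) * (a + U)                        ≡⟨ expand a U ⟩
  a * a + 2 * a * U + U * U                ≤⟨ +-mono-≤ (+-monoʳ-≤ (a * a) cross) (cauchy-schwarz n (u ∘ suc)) ⟩
  a * a + (n * (a * a) + Q) + n * Q        ≡⟨ collect n a Q ⟩
  suc n * (a * a + Q)                      ∎
  where
  open ≤-Reasoning
  a = u 0
  U = ∑ n (u ∘ suc)
  Q = ∑ n (λ i → u (suc i) * u (suc i))
  expand : ∀ a U → (a + U) * (a + U) ≡ a * a + 2 * a * U + U * U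
  expand = solveℕ
  collect : ∀ n a Q → a * a + (n * (a * a) + Q) + n * Q ≡ suc n * (a * a + Q)
  collect = solveℕ
  cross : 2 * a * U ≤ n * (a * a) + Q
  cross = begin
    2 * a * U                                       ≡⟨ ∑-*ˡ n (2 * a) (u ∘ suc) ⟨
    ∑ n (λ i → 2 * a * u (suc i))                   ≤⟨ ∑-mono n (λ i _ → 2ab≤a²+b² a (u (suc i))) ⟩
    ∑ n (λ i → a * a + u (suc i) * u (suc i))       ≡⟨ ∑-+ n (λ _ → a * a) _ ⟩
    ∑ n (λ _ → a * a) + Q                           ≡⟨ cong (_+ Q) (∑-const n (a * a)) ⟩
    n * (a * a) + Q                                 ∎

-- The q class sizes add up to S, and their squares add up to the number of ordered pairs within a
-- class, diagonal included; Cauchy-Schwarz compares the two.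
pigeonhole-pairs : ∀ q S (r : ℕ → ℕ) → (∀ s → s < S → r s < q) →
  S * S ≤ q * ∑ S (λ s → ∑ S (λ s' → 𝟙 (r s' ≟ r s)))
pigeonhole-pairs q S r r<q = begin
  S * S                                              ≡⟨ cong₂ _*_ total total ⟨
  ∑ q c * ∑ q c                                      ≤⟨ cauchy-schwarz q c ⟩
  q * ∑ q (λ ρ → c ρ * c ρ)                          ≡⟨ cong (q *_) pairs ⟨
  q * ∑ S (λ s → c (r s))                            ∎
  where
  open ≤-Reasoning
  c : ℕ → ℕ
  c ρ = ∑ S (λ s → 𝟙 (r s ≟ ρ))
  total : ∑ q c ≡ S
  total = trans (∑-swap q S λ ρ s → 𝟙 (r s ≟ ρ))
    (trans (∑-cong S λ s s<S → ∑-δ₁ q (r<q s s<S)) (trans (∑-const S 1) (*-identityʳ S)))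
  pairs : ∑ S (λ s → c (r s)) ≡ ∑ q (λ ρ → c ρ * c ρ)
  pairs = trans (∑-cong S λ s s<S → sym (∑-δ q c (r<q s s<S)))
    (trans (∑-swap S q λ s ρ → 𝟙 (r s ≟ ρ) * c ρ)
    (∑-cong q λ ρ _ → trans (∑-cong S λ s _ → *-comm (𝟙 (r s ≟ ρ)) (c ρ)) (∑-*ˡ S (c ρ) _)))

-- Divisibility of integers by natural numbers

∣ᵤ-+ : ∀ d i j → d ∣ⁿ ∣ i ∣ → d ∣ⁿ ∣ j ∣ → d ∣ⁿ ∣ i ℤ.+ j ∣
∣ᵤ-+ d i j d∣i d∣j = ℤD.∣⇒∣ᵤ (ℤD.∣m∣n⇒∣m+n (ℤD.∣ᵤ⇒∣ {+ d} {i} d∣i) (ℤD.∣ᵤ⇒∣ {+ d} {j} d∣j))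

∣ᵤ-- : ∀ d i j → d ∣ⁿ ∣ i ∣ → d ∣ⁿ ∣ j ∣ → d ∣ⁿ ∣ i ℤ.- j ∣
∣ᵤ-- d i j d∣i d∣j = ℤD.∣⇒∣ᵤ (ℤD.∣m∣n⇒∣m-n (ℤD.∣ᵤ⇒∣ {+ d} {i} d∣i) (ℤD.∣ᵤ⇒∣ {+ d} {j} d∣j))

∣ᵤ-* : ∀ {c d} i j → c ∣ⁿ ∣ i ∣ → d ∣ⁿ ∣ j ∣ → c * d ∣ⁿ ∣ i ℤ.* j ∣
∣ᵤ-* i j c∣i d∣j = subst (_ ∣ⁿ_) (sym (ℤP.abs-* i j)) (*-pres-∣ c∣i d∣j)

p^n∣ab⇒p^n∣b : ∀ {p} → Prime p → ∀ n a b → ¬ (p ∣ⁿ a) → p ^ n ∣ⁿ a * b → p ^ n ∣ⁿ b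
p^n∣ab⇒p^n∣b pp zero a b p∤a _ = 1∣ b
p^n∣ab⇒p^n∣b {p} pp (suc n) a b p∤a p^∣ab with euclidsLemma a b pp (∣-trans (m∣m*n (p ^ n)) p^∣ab)
... | inj₁ p∣a = contradiction p∣a p∤a
... | inj₂ (divides b' b≡) = subst (p ^ suc n ∣ⁿ_) (trans (*-comm p b') (sym b≡))
  (*-monoʳ-∣ p (p^n∣ab⇒p^n∣b pp n a b' p∤a (*-cancelˡ-∣ p {{prime⇒nonZero pp}}
    (subst (p ^ suc n ∣ⁿ_) (trans (cong (a *_) b≡) (rotate a b' p)) p^∣ab))))
  where
  rotate : ∀ a b p → a * (b * p) ≡ p * (a * b)
  rotate = solveℕ

p^n∣ab⇒p^n∣a⊎p^n∣b : ∀ {p} → Prime p → ∀ n a b → ¬ (p ∣ⁿ a × p ∣ⁿ b) → p ^ n ∣ⁿ a * b → p ^ n ∣ⁿ a ⊎ p ^ n ∣ⁿ b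
p^n∣ab⇒p^n∣a⊎p^n∣b {p} pp n a b ¬both p^∣ab with p ∣? a
... | no  p∤a = inj₂ (p^n∣ab⇒p^n∣b pp n a b p∤a p^∣ab)
... | yes p∣a = inj₁ (p^n∣ab⇒p^n∣b pp n b a (λ p∣b → ¬both (p∣a , p∣b)) (subst (p ^ n ∣ⁿ_) (*-comm a b) p^∣ab))

-- The norm form of ℤ[√-β]; its value at (k, 1) is f(k).
form : ℤ → ℤ → ℤ → ℤ
form β x y = x ℤ.* x ℤ.+ β ℤ.* (y ℤ.* y)

-- The smaller power p^i' divides both u and v, hence κ y and so y. The correction f(k) y² therefore
-- gets p^i from f(k) and p^i' from y, although i + i' may exceed J.
factor-product : ∀ β {p} → Prime p → ∀ {k : ℕ} {J} y u v κ i i' → i' ≤ i → i ≤ J →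
  v ℤ.- u ≡ κ ℤ.* y → ¬ (p ∣ⁿ ∣ κ ∣) → p ^ J ∣ⁿ ∣ f β k ∣ → p ^ i ∣ⁿ ∣ u ∣ → p ^ i' ∣ⁿ ∣ v ∣ →
  p ^ (i + i') ∣ⁿ ∣ u ℤ.* v ℤ.+ f β k ℤ.* (y ℤ.* y) ∣
factor-product β {p} pp {k} y u v κ i i' i'≤i i≤J v-u≡κy p∤κ p^J∣f p^i∣u p^i'∣v =
  subst (_∣ⁿ ∣ u ℤ.* v ℤ.+ f β k ℤ.* (y ℤ.* y) ∣) (sym (^-distribˡ-+-* p i i'))
    (∣ᵤ-+ (p ^ i * p ^ i') (u ℤ.* v) (f β k ℤ.* (y ℤ.* y)) (∣ᵤ-* u v p^i∣u p^i'∣v)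
      (∣ᵤ-* (f β k) (y ℤ.* y) (∣-trans (^-∣ p i≤J) p^J∣f)
        (subst (p ^ i' ∣ⁿ_) (sym (ℤP.abs-* y y)) (∣m⇒∣m*n ∣ y ∣ p^i'∣y))))
  where
  p^i'∣y : p ^ i' ∣ⁿ ∣ y ∣
  p^i'∣y = p^n∣ab⇒p^n∣b pp i' ∣ κ ∣ ∣ y ∣ p∤κ (subst (p ^ i' ∣ⁿ_) (trans (cong ∣_∣ v-u≡κy) (ℤP.abs-* κ y))
             (∣ᵤ-- (p ^ i') v u p^i'∣v (∣-trans (^-∣ p i'≤i) p^i∣u)))

-- If k is a root of f modulo p ^ J, the form factors as (x - k y)(x + k y) modulo p ^ J y².
root-divides-form : ∀ β {p} → Prime p → ∀ {k J} → ¬ (p ∣ⁿ 2) → ¬ (p ∣ⁿ k) → p ^ J ∣ⁿ ∣ f β k ∣ →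
  ∀ x y {i i'} → i ≤ J → i' ≤ J →
  p ^ i ∣ⁿ ∣ x ℤ.- (+ k) ℤ.* y ∣ → p ^ i' ∣ⁿ ∣ x ℤ.- (- (+ k)) ℤ.* y ∣ → p ^ (i + i') ∣ⁿ ∣ form β x y ∣
root-divides-form β {p} pp {k} p∤2 p∤k p^J∣f x y {i} {i'} i≤J i'≤J p^i∣u p^i'∣v with ≤-total i' i
... | inj₁ i'≤i = subst₂ (λ n z → p ^ n ∣ⁿ ∣ z ∣) (refl {x = i + i'}) (identity₁ x y (+ k) β)
  (factor-product β pp {k} y (x ℤ.- (+ k) ℤ.* y) (x ℤ.- (- (+ k)) ℤ.* y) ((+ 2) ℤ.* (+ k)) i i' i'≤i i≤J (difference₁ x y (+ k)) p∤2k p^J∣f p^i∣u p^i'∣v)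
  where
  p∤2k : ¬ (p ∣ⁿ ∣ (+ 2) ℤ.* (+ k) ∣)
  p∤2k d = [ p∤2 , p∤k ]′ (euclidsLemma 2 k pp (subst (p ∣ⁿ_) (ℤP.abs-* (+ 2) (+ k)) d))
  difference₁ : ∀ x y k → (x ℤ.- (- k) ℤ.* y) ℤ.- (x ℤ.- k ℤ.* y) ≡ ((+ 2) ℤ.* k) ℤ.* y
  difference₁ = solveℤ
  identity₁ : ∀ x y k β → (x ℤ.- k ℤ.* y) ℤ.* (x ℤ.- (- k) ℤ.* y) ℤ.+ (k ℤ.* k ℤ.+ β) ℤ.* (y ℤ.* y)
                        ≡ x ℤ.* x ℤ.+ β ℤ.* (y ℤ.* y)
  identity₁ = solveℤ
... | inj₂ i≤i' = subst₂ (λ n z → p ^ n ∣ⁿ ∣ z ∣) (+-comm i' i) (identity₂ x y (+ k) β)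
  (factor-product β pp {k} y (x ℤ.- (- (+ k)) ℤ.* y) (x ℤ.- (+ k) ℤ.* y) (- ((+ 2) ℤ.* (+ k))) i' i i≤i' i'≤J (difference₂ x y (+ k)) p∤-2k p^J∣f p^i'∣v p^i∣u)
  where
  p∤-2k : ¬ (p ∣ⁿ ∣ - ((+ 2) ℤ.* (+ k)) ∣)
  p∤-2k d = [ p∤2 , p∤k ]′ (euclidsLemma 2 k pp
    (subst (p ∣ⁿ_) (trans (ℤP.∣-i∣≡∣i∣ ((+ 2) ℤ.* (+ k))) (ℤP.abs-* (+ 2) (+ k))) d))
  difference₂ : ∀ x y k → (x ℤ.- k ℤ.* y) ℤ.- (x ℤ.- (- k) ℤ.* y) ≡ (- ((+ 2) ℤ.* k)) ℤ.* y
  difference₂ = solveℤ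
  identity₂ : ∀ x y k β → (x ℤ.- (- k) ℤ.* y) ℤ.* (x ℤ.- k ℤ.* y) ℤ.+ (k ℤ.* k ℤ.+ β) ℤ.* (y ℤ.* y)
                        ≡ x ℤ.* x ℤ.+ β ℤ.* (y ℤ.* y)
  identity₂ = solveℤ

congruent-pairs : ∀ q .{{_ : NonZero q}} S (z : ℕ → ℤ) →
  S * S ≤ q * ∑ S (λ s → ∑ S (λ s' → 𝟙 (q ∣? ∣ z s ℤ.- z s' ∣)))
congruent-pairs q S z = ≤-trans (pigeonhole-pairs q S (λ s → z s ℤDM.%ℕ q) (λ s _ → ℤDM.n%ℕd<d (z s) q))
  (*-monoʳ-≤ q (∑-mono S λ s _ → ∑-mono S λ s' _ → 𝟙-mono (_ ≟ _) (q ∣? _) (same-residue (z s') (z s))))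
  where
  cancel : ∀ r a b q → (r ℤ.+ a ℤ.* q) ℤ.- (r ℤ.+ b ℤ.* q) ≡ (a ℤ.- b) ℤ.* q
  cancel = solveℤ
  same-residue : ∀ i j → i ℤDM.%ℕ q ≡ j ℤDM.%ℕ q → q ∣ⁿ ∣ j ℤ.- i ∣
  same-residue i j eq = subst (q ∣ⁿ_) (sym (trans (cong ∣_∣ (begin
      j ℤ.- i
        ≡⟨ cong₂ ℤ._-_ (ℤDM.a≡a%ℕn+[a/ℕn]*n j q) (ℤDM.a≡a%ℕn+[a/ℕn]*n i q) ⟩
      (+ (j ℤDM.%ℕ q) ℤ.+ (j ℤDM./ℕ q) ℤ.* + q) ℤ.- (+ (i ℤDM.%ℕ q) ℤ.+ (i ℤDM./ℕ q) ℤ.* + q)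
        ≡⟨ cong (λ r → (+ (j ℤDM.%ℕ q) ℤ.+ (j ℤDM./ℕ q) ℤ.* + q) ℤ.- (+ r ℤ.+ (i ℤDM./ℕ q) ℤ.* + q)) eq ⟩
      (+ (j ℤDM.%ℕ q) ℤ.+ (j ℤDM./ℕ q) ℤ.* + q) ℤ.- (+ (j ℤDM.%ℕ q) ℤ.+ (i ℤDM./ℕ q) ℤ.* + q)
        ≡⟨ cancel (+ (j ℤDM.%ℕ q)) (j ℤDM./ℕ q) (i ℤDM./ℕ q) (+ q) ⟩
      ((j ℤDM./ℕ q) ℤ.- (i ℤDM./ℕ q)) ℤ.* + q ∎)) (ℤP.abs-* ((j ℤDM./ℕ q) ℤ.- (i ℤDM./ℕ q)) (+ q))))
    (n∣m*n ∣ (j ℤDM./ℕ q) ℤ.- (i ℤDM./ℕ q) ∣)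
    where open ≡-Reasoning

-- Comparison of p-adic valuations

-- The index `s₀` has the largest valuation, so the single number `k s₀` is a root of f modulo every
-- power of p that divides some `h s` with s < S.
module LocalBound
  (β : ℤ) {p : ℕ} (pp : Prime p) (p∤2 : ¬ (p ∣ⁿ 2)) (p∤β : ¬ (p ∣ⁿ ∣ β ∣))
  (e m S : ℕ) (p∤m : ¬ (p ∣ⁿ m))
  (h : ℕ → ℕ) (h>0 : ∀ s → 0 < h s) (h∣f : ∀ s → h s ∣ⁿ ∣ f β (e + m * s) ∣)
  (s₀ : ℕ) (s₀-max : ∀ s → s < S → ν p (h s) ≤ ν p (h s₀)) (p∣hs₀ : p ∣ⁿ h s₀)
  where

  J : ℕ
  J = ν p (h s₀)

  k : ℕ → ℕ
  k s = e + m * s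

  q : ℕ → ℕ
  q j = p ^ suc j

  q≢0 : ∀ j → NonZero (q j)
  q≢0 j = m^n≢0 p (suc j) {{prime⇒nonZero pp}}

  p∤root : ∀ {s} → p ∣ⁿ h s → ¬ (p ∣ⁿ k s)
  p∤root {s} p∣h p∣k = p∤β (subst (λ z → p ∣ⁿ ∣ z ∣) (cancel (+ k s) β)
    (∣ᵤ-- p (f β (k s)) (+ k s ℤ.* + k s) (∣-trans p∣h (h∣f s))
      (subst (p ∣ⁿ_) (sym (ℤP.abs-* (+ k s) (+ k s))) (∣m⇒∣m*n (k s) p∣k))))
    where
    cancel : ∀ k β → (k ℤ.* k ℤ.+ β) ℤ.- k ℤ.* k ≡ β
    cancel = solveℤ

  pᴶ∣f : p ^ J ∣ⁿ ∣ f β (k s₀) ∣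
  pᴶ∣f = ∣-trans (p^ν∣n p (h s₀)) (h∣f s₀)

  -- The difference of the two values of f is (k s - k s₀)(k s + k s₀), and p cannot divide both
  -- factors since it would then divide 2 k s₀. So the whole power falls on one of them.
  root-alternative : ∀ {j s} → j < J → q j ∣ⁿ h s →
    q j ∣ⁿ ∣ + k s ℤ.- + k s₀ ∣ ⊎ q j ∣ⁿ ∣ + k s ℤ.+ + k s₀ ∣
  root-alternative {j} {s} j<J q∣h = p^n∣ab⇒p^n∣a⊎p^n∣b pp (suc j) _ _ not-both
    (subst (q j ∣ⁿ_) (trans (cong ∣_∣ (factor (+ k s) (+ k s₀) β)) (ℤP.abs-* (+ k s ℤ.- + k s₀) (+ k s ℤ.+ + k s₀)))
      (∣ᵤ-- (q j) (f β (k s)) (f β (k s₀)) (∣-trans q∣h (h∣f s)) (∣-trans (^-∣ p j<J) pᴶ∣f)))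
    where
    factor : ∀ a b β → (a ℤ.* a ℤ.+ β) ℤ.- (b ℤ.* b ℤ.+ β) ≡ (a ℤ.- b) ℤ.* (a ℤ.+ b)
    factor = solveℤ
    double : ∀ a b → (a ℤ.+ b) ℤ.- (a ℤ.- b) ≡ (+ 2) ℤ.* b
    double = solveℤ
    not-both : ¬ (p ∣ⁿ ∣ + k s ℤ.- + k s₀ ∣ × p ∣ⁿ ∣ + k s ℤ.+ + k s₀ ∣)
    not-both (p∣- , p∣+) = [ p∤2 , p∤root p∣hs₀ ]′ (euclidsLemma 2 (k s₀) pp
      (subst (p ∣ⁿ_) (trans (cong ∣_∣ (double (+ k s) (+ k s₀))) (ℤP.abs-* (+ 2) (+ k s₀)))
        (∣ᵤ-- p (+ k s ℤ.+ + k s₀) (+ k s ℤ.- + k s₀) p∣+ p∣-)))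

  -- c = ± k s₀ covers both roots modulo q
  translate-count : ∀ j (c : ℤ) → q j * ∑ S (λ s → 𝟙 (q j ∣? ∣ + k s ℤ.+ c ∣)) ≤ S + q j
  translate-count j c = congruent-count (q j) {{q≢0 j}} S (λ s → q j ∣? ∣ + k s ℤ.+ c ∣) λ {s} {s'} _ _ q∣s q∣s' s≤s' →
    p^n∣ab⇒p^n∣b pp (suc j) m (s' ∸ s) p∤m
      (subst (q j ∣ⁿ_) (gap s s' s≤s') (∣ᵤ-- (q j) (+ k s' ℤ.+ c) (+ k s ℤ.+ c) q∣s' q∣s))
    where
    cancel : ∀ a b c → (a ℤ.+ c) ℤ.- (b ℤ.+ c) ≡ a ℤ.- b
    cancel = solveℤ
    gap : ∀ s s' → s ≤ s' → ∣ (+ k s' ℤ.+ c) ℤ.- (+ k s ℤ.+ c) ∣ ≡ m * (s' ∸ s)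
    gap s s' s≤s' = begin
      ∣ (+ k s' ℤ.+ c) ℤ.- (+ k s ℤ.+ c) ∣   ≡⟨ cong ∣_∣ (cancel (+ k s') (+ k s) c) ⟩
      ∣ + k s' ℤ.- + k s ∣                   ≡⟨ cong ∣_∣ (ℤP.m-n≡m⊖n (k s') (k s)) ⟩
      ∣ k s' ℤ.⊖ k s ∣                       ≡⟨ cong ∣_∣ (ℤP.⊖-≥ (+-monoʳ-≤ e (*-monoʳ-≤ m s≤s'))) ⟩
      k s' ∸ k s                             ≡⟨ [m+n]∸[m+o]≡n∸o e (m * s') (m * s) ⟩
      m * s' ∸ m * s                         ≡⟨ *-distribˡ-∸ m s' s ⟨
      m * (s' ∸ s)                           ∎
      where open ≡-Reasoning

  roots : ℕ → ℕ
  roots j = ∑ S (λ s → 𝟙 (q j ∣? h s))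

  roots≤ : ∀ j → j < J → q j * roots j ≤ 2 * (S + q j)
  roots≤ j j<J = begin
    q j * roots j                    ≤⟨ *-monoʳ-≤ (q j) (≤-trans (∑-mono S λ s _ → split s) (≤-reflexive (∑-+ S _ _))) ⟩
    q j * (count k⁻ + count k⁺)      ≡⟨ *-distribˡ-+ (q j) (count k⁻) (count k⁺) ⟩
    q j * count k⁻ + q j * count k⁺  ≤⟨ +-mono-≤ (translate-count j k⁻) (translate-count j k⁺) ⟩
    (S + q j) + (S + q j)            ≡⟨ cong (_+_ (S + q j)) (+-identityʳ (S + q j)) ⟨
    2 * (S + q j)                    ∎
    where
    open ≤-Reasoning
    k⁻ = - (+ k s₀)
    k⁺ = + k s₀
    count : ℤ → ℕ
    count c = ∑ S (λ s → 𝟙 (q j ∣? ∣ + k s ℤ.+ c ∣))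
    split : ∀ s → 𝟙 (q j ∣? h s) ≤ 𝟙 (q j ∣? ∣ + k s ℤ.+ k⁻ ∣) + 𝟙 (q j ∣? ∣ + k s ℤ.+ k⁺ ∣)
    split s with q j ∣? h s
    ... | no _ = z≤n
    ... | yes q∣h with root-alternative {j} {s} j<J q∣h
    ...   | inj₁ d = ≤-trans (≤-reflexive (sym (𝟙-yes (q j ∣? _) d))) (m≤m+n _ _)
    ...   | inj₂ d = ≤-trans (≤-reflexive (sym (𝟙-yes (q j ∣? _) d))) (m≤n+m _ _)

  -- On the diagonal, where the form vanishes, `G` is only required to be positive; `depths≤ν` pays
  -- for those entries separately.
  module Points
    (X Y : ℕ → ℤ) (G : ℕ → ℕ → ℕ) (G>0 : ∀ s s' → 0 < G s s')
    (G≡form : ∀ {s s'} → s < S → s' < S → s ≢ s' → G s s' ≡ ∣ form β (X s ℤ.- X s') (Y s ℤ.- Y s') ∣)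
    where

    line : ℤ → ℕ → ℕ → ℤ
    line κ s s' = (X s ℤ.- X s') ℤ.- κ ℤ.* (Y s ℤ.- Y s')

    hits : ℤ → ℕ → ℕ
    hits κ j = ∑ S (λ s → ∑ S (λ s' → 𝟙 (q j ∣? ∣ line κ s s' ∣)))

    -- `line κ s s'` is the difference of the values of X - κ Y at s and s', so the hits are the
    -- pairs on which this linear function agrees modulo q.
    hits≥ : ∀ κ j → S * S ≤ q j * hits κ j
    hits≥ κ j = subst (λ n → S * S ≤ q j * n)
      (∑-cong S λ s _ → ∑-cong S λ s' _ → cong (λ z → 𝟙 (q j ∣? ∣ z ∣)) (linear (X s) (X s') (Y s) (Y s') κ))
      (congruent-pairs (q j) {{q≢0 j}} S (λ s → X s ℤ.- κ ℤ.* Y s))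
      where
      linear : ∀ x x' y y' κ → (x ℤ.- κ ℤ.* y) ℤ.- (x' ℤ.- κ ℤ.* y') ≡ (x ℤ.- x') ℤ.- κ ℤ.* (y ℤ.- y')
      linear = solveℤ

    κ₁ κ₂ : ℤ
    κ₁ = + k s₀
    κ₂ = - (+ k s₀)

    -- The heart of the comparison, level by level: two roots give at most 2 S² / q + 2 S on the
    -- left, and the two lines collect at least 2 S² / q pairs.
    roots≤hits : ∀ j → j < J → S * roots j ≤ (hits κ₁ j + hits κ₂ j) + 2 * S
    roots≤hits j j<J = *-cancelˡ-≤ (q j) {{q≢0 j}} (begin
      q j * (S * roots j)                                     ≡⟨ rotate (q j) S (roots j) ⟩
      S * (q j * roots j)                                     ≤⟨ *-monoʳ-≤ S (roots≤ j j<J) ⟩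
      S * (2 * (S + q j))                                     ≡⟨ expand S (q j) ⟩
      (S * S + S * S) + q j * (2 * S)                         ≤⟨ +-monoˡ-≤ _ (+-mono-≤ (hits≥ κ₁ j) (hits≥ κ₂ j)) ⟩
      (q j * hits κ₁ j + q j * hits κ₂ j) + q j * (2 * S)     ≡⟨ collect (q j) (hits κ₁ j) (hits κ₂ j) S ⟩
      q j * ((hits κ₁ j + hits κ₂ j) + 2 * S)                 ∎)
      where
      open ≤-Reasoning
      rotate : ∀ a b c → a * (b * c) ≡ b * (a * c)
      rotate = solveℕ
      expand : ∀ S q → S * (2 * (S + q)) ≡ (S * S + S * S) + q * (2 * S)
      expand = solveℕ
      collect : ∀ q a b S → (q * a + q * b) + q * (2 * S) ≡ q * ((a + b) + 2 * S)
      collect = solveℕ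

    -- The valuation of `line κ s s'` cut off at J: the line can be zero, as on the diagonal, and
    -- `k s₀` is a root only modulo p^J.
    depth : ℤ → ℕ → ℕ → ℕ
    depth κ s s' = ∑ J (λ j → 𝟙 (q j ∣? ∣ line κ s s' ∣))

    depth≤J : ∀ κ s s' → depth κ s s' ≤ J
    depth≤J κ s s' = ≤-trans (∑-mono J λ j _ → 𝟙≤1 (q j ∣? ∣ line κ s s' ∣)) (≤-reflexive (trans (∑-const J 1) (*-identityʳ J)))

    p^depth∣line : ∀ κ s s' → p ^ depth κ s s' ∣ⁿ ∣ line κ s s' ∣
    p^depth∣line κ s s' = descending-count (λ i → p ^ i ∣? ∣ line κ s s' ∣) (p^suc∣⇒p^∣ p) (1∣ ∣ line κ s s' ∣) J

    depths≤ν : ∀ s s' → s < S → s' < S → depth κ₁ s s' + depth κ₂ s s' ≤ ν p (G s s') + 𝟙 (s ≟ s') * (2 * J)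
    depths≤ν s s' s<S s'<S = go (s ≟ s')
      where
      go : (d : Dec (s ≡ s')) → depth κ₁ s s' + depth κ₂ s s' ≤ ν p (G s s') + 𝟙 d * (2 * J)
      go (yes _) = ≤-trans (+-mono-≤ (depth≤J κ₁ s s') (depth≤J κ₂ s s'))
        (≤-trans (≤-reflexive (twice J)) (m≤n+m (1 * (2 * J)) (ν p (G s s'))))
        where
        twice : ∀ J → J + J ≡ 1 * (2 * J)
        twice = solveℕ
      go (no s≢s') = ≤-trans (p^e∣n⇒e≤ν pp (G>0 s s') (subst (p ^ (depth κ₁ s s' + depth κ₂ s s') ∣ⁿ_) (sym (G≡form s<S s'<S s≢s'))
        (root-divides-form β pp {k s₀} {J} p∤2 (p∤root {s₀} p∣hs₀) pᴶ∣f (X s ℤ.- X s') (Y s ℤ.- Y s')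
          (depth≤J κ₁ s s') (depth≤J κ₂ s s') (p^depth∣line κ₁ s s') (p^depth∣line κ₂ s s')))) (m≤m+n _ 0)

    ∑hits≡∑depth : ∀ κ → ∑ J (hits κ) ≡ ∑ S (λ s → ∑ S (λ s' → depth κ s s'))
    ∑hits≡∑depth κ = trans (∑-swap J S λ j s → ∑ S (λ s' → 𝟙 (q j ∣? ∣ line κ s s' ∣)))
      (∑-cong S λ s _ → ∑-swap J S λ j s' → 𝟙 (q j ∣? ∣ line κ s s' ∣))

    ∑∑-+ : ∀ (a b : ℕ → ℕ → ℕ) → ∑ S (λ s → ∑ S (λ s' → a s s' + b s s')) ≡ ∑ S (λ s → ∑ S (a s)) + ∑ S (λ s → ∑ S (b s))
    ∑∑-+ a b = trans (∑-cong S λ s _ → ∑-+ S (a s) (b s)) (∑-+ S (λ s → ∑ S (a s)) (λ s → ∑ S (b s)))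

    -- Summation of `roots≤hits` over the levels. The error 4 S J consists of 2 S for each of the J
    -- levels and of 2 J for each of the S diagonal pairs.
    valuation-bound : S * ∑ S (λ s → ν p (h s)) ≤ ∑ S (λ s → ∑ S (λ s' → ν p (G s s'))) + 4 * S * J
    valuation-bound = begin
      S * ∑ S (λ s → ν p (h s))
        -- By maximality of `s₀` no valuation exceeds J, so J levels count each of them in full.
        ≤⟨ *-monoʳ-≤ S (∑-mono S λ s s<S → descending-count-≥ (λ i → p ^ i ∣? h s) (p^suc∣⇒p^∣ p) J (s₀-max s s<S) (p^ν∣n p (h s))) ⟩
      S * ∑ S (λ s → ∑ J (λ j → 𝟙 (q j ∣? h s)))
        ≡⟨ cong (S *_) (∑-swap S J λ s j → 𝟙 (q j ∣? h s)) ⟩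
      S * ∑ J roots
        ≡⟨ ∑-*ˡ J S roots ⟨
      ∑ J (λ j → S * roots j)
        ≤⟨ ∑-mono J roots≤hits ⟩
      ∑ J (λ j → (hits κ₁ j + hits κ₂ j) + 2 * S)
        ≡⟨ trans (∑-+ J (λ j → hits κ₁ j + hits κ₂ j) (λ _ → 2 * S)) (cong₂ _+_ (∑-+ J (hits κ₁) (hits κ₂)) (∑-const J (2 * S))) ⟩
      (∑ J (hits κ₁) + ∑ J (hits κ₂)) + J * (2 * S)
        ≡⟨ cong (_+ J * (2 * S)) (trans (cong₂ _+_ (∑hits≡∑depth κ₁) (∑hits≡∑depth κ₂)) (sym (∑∑-+ (depth κ₁) (depth κ₂)))) ⟩
      ∑ S (λ s → ∑ S (λ s' → depth κ₁ s s' + depth κ₂ s s')) + J * (2 * S)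
        ≤⟨ +-monoˡ-≤ _ (∑-mono S λ s s<S → ∑-mono S λ s' s'<S → depths≤ν s s' s<S s'<S) ⟩
      ∑ S (λ s → ∑ S (λ s' → ν p (G s s') + 𝟙 (s ≟ s') * (2 * J))) + J * (2 * S)
        ≡⟨ cong (_+ J * (2 * S)) (∑∑-+ (λ s s' → ν p (G s s')) (λ s s' → 𝟙 (s ≟ s') * (2 * J))) ⟩
      (V + ∑ S (λ s → ∑ S (λ s' → 𝟙 (s ≟ s') * (2 * J)))) + J * (2 * S)
        ≡⟨ cong (λ n → (V + n) + J * (2 * S)) (trans (∑-cong S λ s s<S → ∑-δ S (λ _ → 2 * J) s<S) (∑-const S (2 * J))) ⟩
      (V + S * (2 * J)) + J * (2 * S)
        ≡⟨ collect V S J ⟩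
      V + 4 * S * J ∎
      where
      open ≤-Reasoning
      V = ∑ S (λ s → ∑ S (λ s' → ν p (G s s')))
      collect : ∀ V S J → (V + S * (2 * J)) + J * (2 * S) ≡ V + 4 * S * J
      collect = solveℕ

-- The form is anisotropic

NonSquare : ℤ → Set
NonSquare i = ¬ (∃ λ (t : ℤ) → t ℤ.* t ≡ i)

i²≡0⇒i≡0 : ∀ i → i ℤ.* i ≡ + 0 → i ≡ + 0
i²≡0⇒i≡0 i i²≡0 = [ id , id ]′ (ℤP.i*j≡0⇒i≡0∨j≡0 i i²≡0)

form≡0⇒x²≡-βy² : ∀ β x y → form β x y ≡ + 0 → x ℤ.* x ≡ - β ℤ.* (y ℤ.* y)
form≡0⇒x²≡-βy² β x y form≡0 = trans (isolate x y β) (trans (cong (ℤ._+ - β ℤ.* (y ℤ.* y)) form≡0) (ℤP.+-identityˡ _))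
  where
  isolate : ∀ x y β → x ℤ.* x ≡ (x ℤ.* x ℤ.+ β ℤ.* (y ℤ.* y)) ℤ.+ - β ℤ.* (y ℤ.* y)
  isolate = solveℤ

-- If y ≠ 0 and x ≠ 0, then y² divides x², so y divides x and the quotient is a square root of
-- `- β`. If y ≠ 0 and x = 0, then `- β` is the square 0.
form≡0⇒y≡0 : ∀ {β} → NonSquare (- β) → ∀ x y → form β x y ≡ + 0 → y ≡ + 0
form≡0⇒y≡0 {β} nonsq x y form≡0 with y ℤP.≟ + 0 | x ℤP.≟ + 0
... | yes y≡0 | _ = y≡0
... | no y≢0 | yes refl = ⊥-elim (nonsq (+ 0 , sym ([ id , (λ y²≡0 → ⊥-elim (y≢0 (i²≡0⇒i≡0 y y²≡0))) ]′
        (ℤP.i*j≡0⇒i≡0∨j≡0 (- β) (sym (form≡0⇒x²≡-βy² β (+ 0) y form≡0))))))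
... | no y≢0 | no x≢0 with ℤD.∣ᵤ⇒∣ {y} {x} (m²∣n²⇒m∣n ∣ y ∣ ∣ x ∣ (abs>0 y≢0) (abs>0 x≢0) (divides ∣ - β ∣ abs-eq))
  where
  abs>0 : ∀ {i} → i ≢ + 0 → 0 < ∣ i ∣
  abs>0 i≢0 = n≢0⇒n>0 λ ∣i∣≡0 → i≢0 (ℤP.∣i∣≡0⇒i≡0 ∣i∣≡0)
  abs-eq : ∣ x ∣ * ∣ x ∣ ≡ ∣ - β ∣ * (∣ y ∣ * ∣ y ∣)
  abs-eq = trans (sym (ℤP.abs-* x x)) (trans (cong ∣_∣ (form≡0⇒x²≡-βy² β x y form≡0))
             (trans (ℤP.abs-* (- β) (y ℤ.* y)) (cong (∣ - β ∣ *_) (ℤP.abs-* y y))))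
...   | ℤD.divides t x≡ty = ⊥-elim (nonsq (t , ℤP.*-cancelʳ-≡ (t ℤ.* t) (- β) (y ℤ.* y) {{y²≢0}}
          (trans (trans (square t y) (cong₂ ℤ._*_ (sym x≡ty) (sym x≡ty))) (form≡0⇒x²≡-βy² β x y form≡0))))
  where
  square : ∀ t y → (t ℤ.* t) ℤ.* (y ℤ.* y) ≡ (t ℤ.* y) ℤ.* (t ℤ.* y)
  square = solveℤ
  y²≢0 : ℤ.NonZero (y ℤ.* y)
  y²≢0 = ℤ.≢-nonZero λ y²≡0 → y≢0 (i²≡0⇒i≡0 y y²≡0)

form≡0⇒x≡0 : ∀ {β} → NonSquare (- β) → ∀ x y → form β x y ≡ + 0 → x ≡ + 0
form≡0⇒x≡0 {β} nonsq x y form≡0 with form≡0⇒y≡0 nonsq x y form≡0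
... | refl = i²≡0⇒i≡0 x (trans (form≡0⇒x²≡-βy² β x (+ 0) form≡0) (ℤP.*-zeroʳ (- β)))

∣form∣≤ : ∀ β x y N → ∣ x ∣ ≤ N → ∣ y ∣ ≤ N → ∣ form β x y ∣ ≤ suc ∣ β ∣ * (N * N)
∣form∣≤ β x y N ∣x∣≤N ∣y∣≤N = ≤-trans (ℤP.∣i+j∣≤∣i∣+∣j∣ (x ℤ.* x) (β ℤ.* (y ℤ.* y)))
  (≤-trans (≤-reflexive (cong₂ _+_ (ℤP.abs-* x x) (trans (ℤP.abs-* β (y ℤ.* y)) (cong (∣ β ∣ *_) (ℤP.abs-* y y)))))
    (+-mono-≤ (*-mono-≤ ∣x∣≤N ∣x∣≤N) (*-monoʳ-≤ ∣ β ∣ (*-mono-≤ ∣y∣≤N ∣y∣≤N))))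

-- The points of the box [0, N)²

module Box (N : ℕ) .{{_ : NonZero N}} where

  X Y : ℕ → ℤ
  X s = + (s / N)
  Y s = + (s % N)

  differences≡0⇒≡ : ∀ s s' → X s ℤ.- X s' ≡ + 0 → Y s ℤ.- Y s' ≡ + 0 → s ≡ s'
  differences≡0⇒≡ s s' x≡0 y≡0 = begin
    s                          ≡⟨ m≡m%n+[m/n]*n s N ⟩
    s % N + s / N * N          ≡⟨ cong₂ (λ y x → y + x * N) (ℤP.+-injective (ℤP.i-j≡0⇒i≡j (Y s) (Y s') y≡0)) (ℤP.+-injective (ℤP.i-j≡0⇒i≡j (X s) (X s') x≡0)) ⟩
    s' % N + s' / N * N        ≡⟨ m≡m%n+[m/n]*n s' N ⟨
    s'                         ∎
    where open ≡-Reasoning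

  ∣difference∣≤ : ∀ {a b} → a ≤ N → b ≤ N → ∣ + a ℤ.- + b ∣ ≤ N
  ∣difference∣≤ {a} {b} a≤N b≤N = ≤-trans (≤-reflexive (cong ∣_∣ (ℤP.m-n≡m⊖n a b)))
    (≤-trans (ℤP.∣m⊝n∣≤m⊔n a b) (⊔-lub a≤N b≤N))

  ∣X-difference∣≤ : ∀ {s s'} → s < N * N → s' < N * N → ∣ X s ℤ.- X s' ∣ ≤ N
  ∣X-difference∣≤ s< s'< = ∣difference∣≤ (<⇒≤ (m<n*o⇒m/o<n s<)) (<⇒≤ (m<n*o⇒m/o<n s'<))

  ∣Y-difference∣≤ : ∀ s s' → ∣ Y s ℤ.- Y s' ∣ ≤ N
  ∣Y-difference∣≤ s s' = ∣difference∣≤ (<⇒≤ (m%n<n s N)) (<⇒≤ (m%n<n s' N))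

-- Comparison of the two products

module Comparison
  (β : ℤ) (nonsq : NonSquare (- β)) (N : ℕ) .{{_ : NonZero N}}
  (e m : ℕ) (h : ℕ → ℕ) (h>0 : ∀ s → 0 < h s) (h∣f : ∀ s → h s ∣ⁿ ∣ f β (e + m * s) ∣)
  (Z : ℕ) (h≤Z : ∀ s → s < N * N → h s ≤ Z)
  (h-coprime : ∀ {p} s → Prime p → p ∣ⁿ h s → ¬ (p ∣ⁿ 2) × ¬ (p ∣ⁿ ∣ β ∣) × ¬ (p ∣ⁿ m))
  (n : ℕ) (smooth : ∀ {p} → Prime p → p ∣ⁿ ∏ (N * N) h → p ≤ n)
  where

  open Box N

  S A : ℕ
  S = N * N
  A = ∏ S h

  S>0 : 0 < S
  S>0 = m*n>0 (>-nonZero⁻¹ N) (>-nonZero⁻¹ N)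

  A>0 : 0 < A
  A>0 = ∏>0 S λ s _ → h>0 s

  -- The maximum with 1 changes only the diagonal entries, which would otherwise make the product
  -- `Π` zero.
  G : ℕ → ℕ → ℕ
  G s s' = ∣ form β (X s ℤ.- X s') (Y s ℤ.- Y s') ∣ ⊔ 1

  G>0 : ∀ s s' → 0 < G s s'
  G>0 s s' = m≤n⊔m ∣ form β (X s ℤ.- X s') (Y s ℤ.- Y s') ∣ 1

  G≡form : ∀ {s s'} → s < S → s' < S → s ≢ s' → G s s' ≡ ∣ form β (X s ℤ.- X s') (Y s ℤ.- Y s') ∣
  G≡form {s} {s'} _ _ s≢s' = m≥n⇒m⊔n≡m (n≢0⇒n>0 λ ∣form∣≡0 → let form≡0 = ℤP.∣i∣≡0⇒i≡0 ∣form∣≡0 in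
    s≢s' (differences≡0⇒≡ s s' (form≡0⇒x≡0 nonsq (X s ℤ.- X s') (Y s ℤ.- Y s') form≡0)
                               (form≡0⇒y≡0 nonsq (X s ℤ.- X s') (Y s ℤ.- Y s') form≡0)))

  c : ℕ
  c = suc ∣ β ∣

  G≤ : ∀ s s' → s < S → s' < S → G s s' ≤ c * S
  G≤ s s' s<S s'<S = ⊔-lub (∣form∣≤ β (X s ℤ.- X s') (Y s ℤ.- Y s') N (∣X-difference∣≤ s<S s'<S) (∣Y-difference∣≤ s s'))
    (m*n>0 {c} z<s S>0)

  Π : ℕ
  Π = ∏ S (λ s → ∏ S (G s))

  Π>0 : 0 < Π
  Π>0 = ∏>0 S λ s _ → ∏>0 S λ s' _ → G>0 s s'

  Π≤ : Π ≤ ((c * S) ^ S) ^ S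
  Π≤ = ≤-trans (∏-mono S λ s s<S → ≤-trans (∏-mono S λ s' s'<S → G≤ s s' s<S s'<S) (≤-reflexive (∏-const S (c * S))))
         (≤-reflexive (∏-const S ((c * S) ^ S)))

  ν-Π : ∀ {p} → Prime p → ν p Π ≡ ∑ S (λ s → ∑ S (λ s' → ν p (G s s')))
  ν-Π pp = trans (ν-∏ pp S λ s _ → ∏>0 S λ s' _ → G>0 s s') (∑-cong S λ s _ → ν-∏ pp S λ s' _ → G>0 s s')

  deepest : ∀ p → ∃ λ s → s < S × (∀ s' → s' < S → ν p (h s') ≤ ν p (h s))
  deepest p = argmax S (λ s → ν p (h s)) S>0

  J : ℕ → ℕ
  J p = ν p (h (proj₁ (deepest p)))

  -- The part of the least common multiple of the `h s`, s < S, that is made of primes up to n. Each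
  -- prime contributes a divisor of a single `h s`, hence at most Z.
  E : ℕ
  E = ∏ (suc n) (λ p → (p ^ J p) ^ 𝟙 (prime? p))

  E-factor>0 : ∀ p → 0 < (p ^ J p) ^ 𝟙 (prime? p)
  E-factor>0 p with prime? p
  ... | yes pp = subst (0 <_) (sym (*-identityʳ (p ^ J p))) (p^>0 pp (J p))
  ... | no _   = z<s

  E>0 : 0 < E
  E>0 = ∏>0 (suc n) λ p _ → E-factor>0 p

  E≤ : E ≤ Z ^ primeCount n
  E≤ = ≤-trans (∏-mono (suc n) λ p _ → ^-monoˡ-≤ (𝟙 (prime? p)) (p^J≤Z p))
         (≤-reflexive (∏-^ (suc n) Z λ p → 𝟙 (prime? p)))
    where
    p^J≤Z : ∀ p → p ^ J p ≤ Z
    p^J≤Z p = ≤-trans (∣⇒≤ {{>-nonZero (h>0 _)}} (p^ν∣n p (h (proj₁ (deepest p))))) (h≤Z _ (proj₁ (proj₂ (deepest p))))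

  J≤ν-E : ∀ {p} → Prime p → p ≤ n → J p ≤ ν p E
  J≤ν-E {p} pp p≤n = p^e∣n⇒e≤ν pp E>0 (∣-trans
    (ℕD.∣-reflexive (trans (sym (*-identityʳ (p ^ J p))) (cong ((p ^ J p) ^_) (sym (𝟙-yes (prime? p) pp)))))
    (factor∣∏ (λ p → (p ^ J p) ^ 𝟙 (prime? p)) (s≤s p≤n)))

  E⁴ˢ>0 : 0 < E ^ (4 * S)
  E⁴ˢ>0 = m^n>0 E {{>-nonZero E>0}} (4 * S)

  ν-comparison : ∀ p → Prime p → ν p (A ^ S) ≤ ν p (Π * E ^ (4 * S))
  ν-comparison p pp with p ∣? A
  ... | no p∤A = ≤-trans (≤-reflexive (trans (ν-^ pp A>0 S) (trans (cong (S *_) (n≤0⇒n≡0 (≮⇒≥ λ ν>0 → p∤A (ν>0⇒p∣n ν>0)))) (*-zeroʳ S)))) z≤n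
  ... | yes p∣A with prime∣∏⇒∣factor pp S h p∣A
  ...   | s₁ , s₁<S , p∣h = begin
    ν p (A ^ S)                                                    ≡⟨ ν-^ pp A>0 S ⟩
    S * ν p A                                                      ≡⟨ cong (S *_) (ν-∏ pp S λ s _ → h>0 s) ⟩
    S * ∑ S (λ s → ν p (h s))                                      ≤⟨ valuation-bound ⟩
    -- Smoothness enters here: p ≤ n, so p^(J p) is among the factors of `E`.
    ∑ S (λ s → ∑ S (λ s' → ν p (G s s'))) + 4 * S * J p            ≤⟨ +-monoʳ-≤ _ (*-monoʳ-≤ (4 * S) (J≤ν-E pp (smooth pp p∣A))) ⟩
    ∑ S (λ s → ∑ S (λ s' → ν p (G s s'))) + 4 * S * ν p E          ≡⟨ cong₂ _+_ (ν-Π pp) (ν-^ pp E>0 (4 * S)) ⟨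
    ν p Π + ν p (E ^ (4 * S))                                      ≡⟨ ν-* pp Π>0 E⁴ˢ>0 ⟨
    ν p (Π * E ^ (4 * S))                                          ∎
    where
    open ≤-Reasoning
    s₀ = proj₁ (deepest p)
    s₀-max = proj₂ (proj₂ (deepest p))
    p∣hs₀ : p ∣ⁿ h s₀
    p∣hs₀ = ν>0⇒p∣n (≤-trans (p∣n⇒ν>0 pp (h>0 s₁) p∣h) (s₀-max s₁ s₁<S))
    coprime = h-coprime s₀ pp p∣hs₀
    open LocalBound β pp (proj₁ coprime) (proj₁ (proj₂ coprime)) e m S (proj₂ (proj₂ coprime)) h h>0 h∣f s₀ s₀-max p∣hs₀ using (module Points)
    open Points X Y G G>0 G≡form using (valuation-bound)

  comparison : A ^ S ≤ ((c * S) ^ S) ^ S * (Z ^ primeCount n) ^ (4 * S)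
  comparison = ≤-trans (∣⇒≤ {{>-nonZero (m*n>0 Π>0 E⁴ˢ>0)}}
      (∣-from-ν (A ^ S) (Π * E ^ (4 * S)) (m^n>0 A {{>-nonZero A>0}} S) (m*n>0 Π>0 E⁴ˢ>0) ν-comparison))
    (*-mono-≤ Π≤ (^-monoˡ-≤ (4 * S) E≤))

-- Growth estimates

^-distribʳ-* : ∀ n a b → (a * b) ^ n ≡ a ^ n * b ^ n
^-distribʳ-* n a b = trans (sym (∏-const n (a * b)))
  (trans (∏-* n (λ _ → a) (λ _ → b)) (cong₂ _*_ (∏-const n a) (∏-const n b)))

^-cancelˡ-≤ : ∀ n .{{_ : NonZero n}} a b → a ^ n ≤ b ^ n → a ≤ b
^-cancelˡ-≤ n a b aⁿ≤bⁿ = ≮⇒≥ λ b<a → <⇒≱ (^-monoˡ-< n b<a) aⁿ≤bⁿ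

-- Taking S-th roots and cancelling S^S leaves S^S ≤ c^S S^(12 π), where 12 is the exponent 3 of the
-- bound S³ for the factors times the 4 of the error 4 S J. Squaring and 24 π ≤ S give S^S ≤ c^(2
-- S).
growth : ∀ c S A π → 0 < S → (S * S) ^ S ≤ A → A ^ S ≤ ((c * S) ^ S) ^ S * ((S * S * S) ^ π) ^ (4 * S) →
  24 * π ≤ S → S ≤ c * c
growth c S A π S>0 S²ˢ≤A Aˢ≤ 24π≤S = ^-cancelˡ-≤ S S (c * c) (*-cancelˡ-≤ (S ^ S) (begin
  S ^ S * S ^ S                          ≤⟨ *-mono-≤ Sˢ≤ Sˢ≤ ⟩
  (c ^ S * R) * (c ^ S * R)              ≡⟨ *-interchange (c ^ S) R (c ^ S) R ⟩
  (c ^ S * c ^ S) * (R * R)              ≤⟨ *-monoʳ-≤ (c ^ S * c ^ S) R²≤ ⟩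
  (c ^ S * c ^ S) * S ^ S                ≡⟨ cong (_* S ^ S) (^-distribʳ-* S c c) ⟨
  (c * c) ^ S * S ^ S                    ≡⟨ *-comm ((c * c) ^ S) (S ^ S) ⟩
  S ^ S * (c * c) ^ S                    ∎))
  where
  open ≤-Reasoning
  instance
    S≢0 : NonZero S
    S≢0 = >-nonZero S>0
    Sˢ≢0 : NonZero (S ^ S)
    Sˢ≢0 = m^n≢0 S S
  R = (S * S * S) ^ (π * 4)
  root : (S * S) ^ S ≤ (c * S) ^ S * R
  root = ^-cancelˡ-≤ S _ _ (begin
    ((S * S) ^ S) ^ S                                       ≤⟨ ^-monoˡ-≤ S S²ˢ≤A ⟩
    A ^ S                                                   ≤⟨ Aˢ≤ ⟩
    ((c * S) ^ S) ^ S * ((S * S * S) ^ π) ^ (4 * S)         ≡⟨ cong (((c * S) ^ S) ^ S *_) (trans (sym (^-*-assoc _ 4 S)) (cong (_^ S) (^-*-assoc _ π 4))) ⟩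
    ((c * S) ^ S) ^ S * R ^ S                               ≡⟨ ^-distribʳ-* S ((c * S) ^ S) R ⟨
    ((c * S) ^ S * R) ^ S                                   ∎)
  Sˢ≤ : S ^ S ≤ c ^ S * R
  Sˢ≤ = *-cancelˡ-≤ (S ^ S) (begin
    S ^ S * S ^ S              ≡⟨ ^-distribʳ-* S S S ⟨
    (S * S) ^ S                ≤⟨ root ⟩
    (c * S) ^ S * R            ≡⟨ cong (_* R) (trans (^-distribʳ-* S c S) (*-comm (c ^ S) (S ^ S))) ⟩
    (S ^ S * c ^ S) * R        ≡⟨ *-assoc (S ^ S) (c ^ S) R ⟩
    S ^ S * (c ^ S * R)        ∎)
  R≡ : R ≡ S ^ (12 * π)
  R≡ = trans (cong (_^ (π * 4)) (cube S)) (trans (^-*-assoc S 3 (π * 4)) (cong (S ^_) (twelve π)))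
    where
    cube : ∀ S → S * S * S ≡ S * (S * (S * 1))
    cube = solveℕ
    twelve : ∀ π → 3 * (π * 4) ≡ 12 * π
    twelve = solveℕ
  R²≤ : R * R ≤ S ^ S
  R²≤ = begin
    R * R                            ≡⟨ cong₂ _*_ R≡ R≡ ⟩
    S ^ (12 * π) * S ^ (12 * π)      ≡⟨ ^-distribˡ-+-* S (12 * π) (12 * π) ⟨
    S ^ (12 * π + 12 * π)            ≡⟨ cong (S ^_) (*-distribʳ-+ π 12 12) ⟨
    S ^ (24 * π)                     ≤⟨ ^-monoʳ-≤ S 24π≤S ⟩
    S ^ S                            ∎

-- The box size N in terms of n

√-floor : ∀ u → ∃ λ N → N * N ≤ u × u < suc N * suc N
√-floor zero = 0 , z≤n , z<s
√-floor (suc u) with √-floor u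
... | N , N²≤u , u< with suc u <? suc N * suc N
...   | yes 1+u< = N , m≤n⇒m≤1+n N²≤u , 1+u<
...   | no  1+u≮ = suc N , ≮⇒≥ 1+u≮ , ≤-<-trans u< (*-mono-< (n<1+n (suc N)) (n<1+n (suc N)))

-- N is the integer part of √(n / g). The factor 4 comes from N + 1 ≤ 2 N, and n > g T² forces N ≥
-- T.
quadratic-scale : ∀ g T → 0 < g → 0 < T → ∃ λ B → ∀ n → n > B → ∃ λ N → T ≤ N × g * (N * N) ≤ n × n ≤ 4 * g * (N * N)
quadratic-scale g T g>0 T>0 = g * (T * T) , scale
  where
  open ≤-Reasoning
  instance
    g≢0 : NonZero g
    g≢0 = >-nonZero g>0
  scale : ∀ n → n > g * (T * T) → ∃ λ N → T ≤ N × g * (N * N) ≤ n × n ≤ 4 * g * (N * N)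
  scale n n>B with √-floor (n / g)
  ... | N , N²≤u , u< = N , T≤N , lower , upper
    where
    n≤ : n ≤ g * (suc N * suc N)
    n≤ = begin
      n                        ≡⟨ m≡m%n+[m/n]*n n g ⟩
      n % g + n / g * g        ≤⟨ +-monoˡ-≤ _ (<⇒≤ (m%n<n n g)) ⟩
      suc (n / g) * g          ≤⟨ *-monoˡ-≤ g u< ⟩
      (suc N * suc N) * g      ≡⟨ *-comm (suc N * suc N) g ⟩
      g * (suc N * suc N)      ∎
    T≤N : T ≤ N
    T≤N = ≮⇒≥ λ N<T → <⇒≱ n>B (≤-trans n≤ (*-monoʳ-≤ g (*-mono-≤ N<T N<T)))
    lower : g * (N * N) ≤ n
    lower = begin
      g * (N * N)     ≤⟨ *-monoʳ-≤ g N²≤u ⟩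
      g * (n / g)     ≡⟨ *-comm g (n / g) ⟩
      n / g * g       ≤⟨ m/n*n≤m n g ⟩
      n               ∎
    1+N≤2N : suc N ≤ 2 * N
    1+N≤2N = ≤-trans (+-monoˡ-≤ N (≤-trans T>0 T≤N)) (≤-reflexive (cong (_+_ N) (sym (+-identityʳ N))))
    upper : n ≤ 4 * g * (N * N)
    upper = begin
      n                            ≤⟨ n≤ ⟩
      g * (suc N * suc N)          ≤⟨ *-monoʳ-≤ g (*-mono-≤ 1+N≤2N 1+N≤2N) ⟩
      g * (2 * N * (2 * N))        ≡⟨ arith g N ⟩
      4 * g * (N * N)              ∎
      where
      arith : ∀ g N → g * (2 * N * (2 * N)) ≡ 4 * g * (N * N)
      arith = solveℕ

-- S consecutive terms of the progression d + m ℕ in [α n / D, (α + 1) n / D]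

module Window (α D d m n S : ℕ) .{{_ : NonZero (D * m)}} (D≤Dm : D ≤ D * m)
  (2DmS≤n : 2 * (D * m) * S ≤ n) (d≤S : d ≤ S) where

  open ≤-Reasoning

  t₀ : ℕ
  t₀ = suc (α * n / (D * m))

  term-expand : ∀ s → D * (d + m * (t₀ + s)) ≡ D * d + (D * m * t₀ + D * m * s)
  term-expand s = arith D d m t₀ s
    where
    arith : ∀ D d m t s → D * (d + m * (t + s)) ≡ D * d + (D * m * t + D * m * s)
    arith = solveℕ

  term≥ : ∀ s → α * n ≤ D * (d + m * (t₀ + s))
  term≥ s = begin
    α * n                                                ≡⟨ m≡m%n+[m/n]*n (α * n) (D * m) ⟩
    α * n % (D * m) + α * n / (D * m) * (D * m)          ≤⟨ +-monoˡ-≤ _ (<⇒≤ (m%n<n (α * n) (D * m))) ⟩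
    t₀ * (D * m)                                         ≡⟨ *-comm t₀ (D * m) ⟩
    D * m * t₀                                           ≤⟨ m≤m+n _ _ ⟩
    D * m * t₀ + D * m * s                               ≤⟨ m≤n+m _ (D * d) ⟩
    D * d + (D * m * t₀ + D * m * s)                     ≡⟨ term-expand s ⟨
    D * (d + m * (t₀ + s))                               ∎

  -- Scaled by D, the window has length n. One D m S covers the offset d, another the rounding in
  -- `t₀` together with the s steps; hence the 2 in `2DmS≤n`.
  term≤ : ∀ s → s < S → D * (d + m * (t₀ + s)) ≤ suc α * n
  term≤ s s<S = begin
    D * (d + m * (t₀ + s))                               ≡⟨ term-expand s ⟩
    D * d + (D * m * t₀ + D * m * s)                     ≤⟨ +-mono-≤ (*-mono-≤ D≤Dm d≤S) (+-monoˡ-≤ (D * m * s) Dmt₀≤) ⟩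
    D * m * S + (D * m + α * n + D * m * s)              ≡⟨ arith (D * m) S (α * n) s ⟩
    α * n + (D * m * S + D * m * suc s)                  ≤⟨ +-monoʳ-≤ (α * n) (+-monoʳ-≤ (D * m * S) (*-monoʳ-≤ (D * m) s<S)) ⟩
    α * n + (D * m * S + D * m * S)                      ≡⟨ double (α * n) (D * m) S ⟩
    2 * (D * m) * S + α * n                              ≤⟨ +-monoˡ-≤ (α * n) 2DmS≤n ⟩
    suc α * n                                            ∎
    where
    arith : ∀ G S x s → G * S + (G + x + G * s) ≡ x + (G * S + G * suc s)
    arith = solveℕ
    double : ∀ x G S → x + (G * S + G * S) ≡ 2 * G * S + x
    double = solveℕ
    Dmt₀≤ : D * m * t₀ ≤ D * m + α * n
    Dmt₀≤ = begin
      D * m * t₀                                  ≡⟨ *-comm (D * m) t₀ ⟩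
      D * m + α * n / (D * m) * (D * m)           ≤⟨ +-monoʳ-≤ (D * m) (m/n*n≤m (α * n) (D * m)) ⟩
      D * m + α * n                               ∎

-- Rational multiples of naturals

-- Unnormalised products carry no gcd, so comparisons become integer inequalities by
-- cross-multiplication.
toℚᵘ-multiple : ∀ a n → ℚ.toℚᵘ (a ℚ.* ℕ→ℚ n) ℚᵘ.≃ ℚ.toℚᵘ a ℚᵘ.* ℚᵘ.mkℚᵘ (+ n) 0
toℚᵘ-multiple a n = ℚᵘP.≃-trans (ℚP.toℚᵘ-homo-* a (ℕ→ℚ n))
  (ℚᵘP.*-congˡ {ℚ.toℚᵘ a} (ℚP.toℚᵘ-fromℚᵘ (ℚᵘ.mkℚᵘ (+ n) 0)))

multiple≤ : ∀ a {u} n k → ℚ.↥ a ≡ + u → u * n ≤ ℚ.↧ₙ a * k → a ℚ.* ℕ→ℚ n ℚ.≤ ℕ→ℚ k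
multiple≤ a@(ℚ.mkℚ _ d-1 _) {u} n k refl un≤dk = ℚP.toℚᵘ-cancel-≤
  (ℚᵘP.≤-respˡ-≃ (ℚᵘP.≃-sym (toℚᵘ-multiple a n))
  (ℚᵘP.≤-respʳ-≃ (ℚᵘP.≃-sym (ℚP.toℚᵘ-fromℚᵘ (ℚᵘ.mkℚᵘ (+ k) 0)))
  (ℚᵘ.*≤* (subst₂ ℤ._≤_ lhs rhs (ℤ.+≤+ un≤dk)))))
  where
  lhs : + (u * n) ≡ (+ u ℤ.* + n) ℤ.* + 1
  lhs = trans (ℤP.pos-* u n) (sym (ℤP.*-identityʳ (+ u ℤ.* + n)))
  rhs : + (suc d-1 * k) ≡ + k ℤ.* (+ (suc d-1 * 1))
  rhs = trans (cong +_ (trans (*-comm (suc d-1) k) (cong (k *_) (sym (*-identityʳ (suc d-1)))))) (ℤP.pos-* k (suc d-1 * 1))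

≤multiple : ∀ a {u} n k → ℚ.↥ a ≡ + u → ℚ.↧ₙ a * k ≤ u * n → ℕ→ℚ k ℚ.≤ a ℚ.* ℕ→ℚ n
≤multiple a@(ℚ.mkℚ _ d-1 _) {u} n k refl dk≤un = ℚP.toℚᵘ-cancel-≤
  (ℚᵘP.≤-respʳ-≃ (ℚᵘP.≃-sym (toℚᵘ-multiple a n))
  (ℚᵘP.≤-respˡ-≃ (ℚᵘP.≃-sym (ℚP.toℚᵘ-fromℚᵘ (ℚᵘ.mkℚᵘ (+ k) 0)))
  (ℚᵘ.*≤* (subst₂ ℤ._≤_ lhs rhs (ℤ.+≤+ dk≤un)))))
  where
  lhs : + (suc d-1 * k) ≡ + k ℤ.* (+ (suc d-1 * 1))
  lhs = trans (cong +_ (trans (*-comm (suc d-1) k) (cong (k *_) (sym (*-identityʳ (suc d-1)))))) (ℤP.pos-* k (suc d-1 * 1))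
  rhs : + (u * n) ≡ (+ u ℤ.* + n) ℤ.* + 1
  rhs = trans (ℤP.pos-* u n) (sym (ℤP.*-identityʳ (+ u ℤ.* + n)))

-- With a = u / d₁ < v / d₂ = b over the denominator D = 2 d₁ d₂, the interval [a, b] contains
-- [α / D, (α + 1) / D] for α = 2 u d₂ + 1, which stays away from 0.
rational-window : ∀ a b → 0ℚ ℚ.≤ a → a ℚ.< b → ∃ λ α → ∃ λ D → 0 < α × 0 < D ×
  (∀ n k → α * n ≤ D * k → D * k ≤ suc α * n →
    a ℚ.* ℕ→ℚ n ℚ.≤ ℕ→ℚ k × ℕ→ℚ k ℚ.≤ b ℚ.* ℕ→ℚ n × k ≤ ∣ ℚ.↥ b ∣ * n)
rational-window (ℚ.mkℚ ℤ.-[1+ _ ] _ _) b (ℚ.*≤* ()) a<b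
-- Written as one natural number, the left side is visibly nonnegative and cannot lie below a
-- negative one.
rational-window (ℚ.mkℚ (+ u) _ _) (ℚ.mkℚ ℤ.-[1+ _ ] _ _) 0≤a (ℚ.*<* a<b) with subst (ℤ._< _) (sym (ℤP.pos-* u _)) a<b
... | ()
rational-window a@(ℚ.mkℚ (+ u) d₁-1 _) b@(ℚ.mkℚ (+ v) d₂-1 _) 0≤a (ℚ.*<* a<b) =
  suc (2 * (u * d₂)) , 2 * (d₁ * d₂) , z<s , z<s , λ n k α≤ ≤α+1 →
    let d₂k≤vn = *-cancelˡ-≤ (2 * d₁) (begin
          2 * d₁ * (d₂ * k)                     ≡⟨ assoc d₁ d₂ k ⟩
          2 * (d₁ * d₂) * k                     ≤⟨ ≤α+1 ⟩
          suc (suc (2 * (u * d₂))) * n          ≡⟨ cong (_* n) (*-distribˡ-+ 2 1 (u * d₂)) ⟨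
          2 * suc (u * d₂) * n                  ≤⟨ *-monoˡ-≤ n (*-monoʳ-≤ 2 ud₂<vd₁) ⟩
          2 * (v * d₁) * n                      ≡⟨ assoc' v d₁ n ⟩
          2 * d₁ * (v * n)                      ∎)
    in
    multiple≤ a n k refl (*-cancelˡ-≤ (2 * d₂) (begin
      2 * d₂ * (u * n)                      ≡⟨ assoc' u d₂ n ⟨
      2 * (u * d₂) * n                      ≤⟨ *-monoˡ-≤ n (n≤1+n (2 * (u * d₂))) ⟩
      suc (2 * (u * d₂)) * n                ≤⟨ α≤ ⟩
      2 * (d₁ * d₂) * k                     ≡⟨ assoc'' d₁ d₂ k ⟩
      2 * d₂ * (d₁ * k)                     ∎)) ,
    ≤multiple b n k refl d₂k≤vn ,
    ≤-trans (m≤n*m k d₂) d₂k≤vn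
  where
  open ≤-Reasoning
  d₁ = suc d₁-1
  d₂ = suc d₂-1
  ud₂<vd₁ : u * d₂ < v * d₁
  ud₂<vd₁ = ℤP.drop‿+<+ (subst₂ ℤ._<_ (sym (ℤP.pos-* u d₂)) (sym (ℤP.pos-* v d₁)) a<b)
  assoc : ∀ x y k → 2 * x * (y * k) ≡ 2 * (x * y) * k
  assoc = solveℕ
  assoc' : ∀ v x n → 2 * (v * x) * n ≡ 2 * x * (v * n)
  assoc' = solveℕ
  assoc'' : ∀ x y k → 2 * (x * y) * k ≡ 2 * y * (x * k)
  assoc'' = solveℕ

-- f along the progression d + m ℕ

∣i∣²≡i² : ∀ i → + (∣ i ∣ * ∣ i ∣) ≡ i ℤ.* i
∣i∣²≡i² (+ n)        = ℤP.pos-* n n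
∣i∣²≡i² ℤ.-[1+ n ]   = refl

f≢0 : ∀ {β} → NonSquare (- β) → ∀ k → f β k ≢ + 0
f≢0 {β} nonsq k f≡0 = nonsq (+ k , trans (isolate (+ k) β) (trans (cong (ℤ._- β) f≡0) (ℤP.+-identityˡ (- β))))
  where
  isolate : ∀ k β → k ℤ.* k ≡ (k ℤ.* k ℤ.+ β) ℤ.- β
  isolate = solveℤ

∣f∣≤ : ∀ β k → ∣ f β k ∣ ≤ k * k + ∣ β ∣
∣f∣≤ β k = ≤-trans (ℤP.∣i+j∣≤∣i∣+∣j∣ (+ k ℤ.* + k) β) (≤-reflexive (cong (_+ ∣ β ∣) (ℤP.abs-* (+ k) (+ k))))

k²≤∣f∣+∣β∣ : ∀ β k → k * k ≤ ∣ f β k ∣ + ∣ β ∣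
k²≤∣f∣+∣β∣ β k = ≤-trans (≤-reflexive (trans (sym (ℤP.abs-* (+ k) (+ k))) (cong ∣_∣ (isolate (+ k) β))))
  (≤-trans (ℤP.∣i+j∣≤∣i∣+∣j∣ (f β k) (- β)) (≤-reflexive (cong (_+_ ∣ f β k ∣) (ℤP.∣-i∣≡∣i∣ β))))
  where
  isolate : ∀ k β → k ℤ.* k ≡ (k ℤ.* k ℤ.+ β) ℤ.- β
  isolate = solveℤ

nonzero-factor≤ : ∀ {u v} → 0 < v → u ∣ⁿ v → u ≤ v
nonzero-factor≤ v>0 = ∣⇒≤ {{>-nonZero v>0}}

-- The modulus m is chosen so that f (d + m t) = f(d) H(t) with H(t) ≡ 1 modulo w, which is divisible by
-- 2, β and every prime factor of m: the bad primes only occur in the constant f(d).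
module Progression (β : ℤ) (nonsq : NonSquare (- β)) (c d : ℕ) (c>0 : 0 < c) where

  φ : ℤ
  φ = f β d

  -- One factor φ is divided out of f, the other remains in `w` to keep the primes of φ away from
  -- `H`. Squared absolute values equal the integer squares, which removes the signs.
  m : ℕ
  m = 2 * c * (∣ β ∣ * ∣ β ∣) * (∣ φ ∣ * ∣ φ ∣)

  w : ℤ
  w = + (2 * c) ℤ.* (β ℤ.* β) ℤ.* φ

  H : ℕ → ℤ
  H t = + 1 ℤ.+ w ℤ.* + t ℤ.* (+ 2 ℤ.* + d ℤ.+ + m ℤ.* + t)

  m≡φw : + m ≡ φ ℤ.* w
  m≡φw = begin
    + m                                                              ≡⟨ ℤP.pos-* (2 * c * (∣ β ∣ * ∣ β ∣)) (∣ φ ∣ * ∣ φ ∣) ⟩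
    + (2 * c * (∣ β ∣ * ∣ β ∣)) ℤ.* + (∣ φ ∣ * ∣ φ ∣)                ≡⟨ cong₂ ℤ._*_ (trans (ℤP.pos-* (2 * c) (∣ β ∣ * ∣ β ∣)) (cong (+ (2 * c) ℤ.*_) (∣i∣²≡i² β))) (∣i∣²≡i² φ) ⟩
    + (2 * c) ℤ.* (β ℤ.* β) ℤ.* (φ ℤ.* φ)                            ≡⟨ rotate (+ (2 * c) ℤ.* (β ℤ.* β)) φ ⟩
    φ ℤ.* w                                                          ∎
    where
    open ≡-Reasoning
    rotate : ∀ x φ → x ℤ.* (φ ℤ.* φ) ≡ φ ℤ.* (x ℤ.* φ)
    rotate = solveℤ

  f≡φH : ∀ t → f β (d + m * t) ≡ φ ℤ.* H t
  f≡φH t = begin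
    f β (d + m * t)                                                          ≡⟨ cong (λ k → k ℤ.* k ℤ.+ β) k≡ ⟩
    (+ d ℤ.+ φ ℤ.* w ℤ.* + t) ℤ.* (+ d ℤ.+ φ ℤ.* w ℤ.* + t) ℤ.+ β           ≡⟨ factor (+ d) β w (+ t) ⟩
    φ ℤ.* (+ 1 ℤ.+ w ℤ.* + t ℤ.* (+ 2 ℤ.* + d ℤ.+ φ ℤ.* w ℤ.* + t))         ≡⟨ cong (λ z → φ ℤ.* (+ 1 ℤ.+ w ℤ.* + t ℤ.* (+ 2 ℤ.* + d ℤ.+ z ℤ.* + t))) m≡φw ⟨
    φ ℤ.* H t                                                                ∎
    where
    open ≡-Reasoning
    k≡ : + (d + m * t) ≡ + d ℤ.+ φ ℤ.* w ℤ.* + t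
    k≡ = trans (ℤP.pos-+ d (m * t)) (cong (ℤ._+_ (+ d)) (trans (ℤP.pos-* m t) (cong (ℤ._* + t) m≡φw)))
    factor : ∀ d β w t → (d ℤ.+ (d ℤ.* d ℤ.+ β) ℤ.* w ℤ.* t) ℤ.* (d ℤ.+ (d ℤ.* d ℤ.+ β) ℤ.* w ℤ.* t) ℤ.+ β
      ≡ (d ℤ.* d ℤ.+ β) ℤ.* (+ 1 ℤ.+ w ℤ.* t ℤ.* (+ 2 ℤ.* d ℤ.+ (d ℤ.* d ℤ.+ β) ℤ.* w ℤ.* t))
    factor = solveℤ

  ∣f∣≡ : ∀ t → ∣ f β (d + m * t) ∣ ≡ ∣ φ ∣ * ∣ H t ∣
  ∣f∣≡ t = trans (cong ∣_∣ (f≡φH t)) (ℤP.abs-* φ (H t))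

  H∣f : ∀ t → ∣ H t ∣ ∣ⁿ ∣ f β (d + m * t) ∣
  H∣f t = subst (∣ H t ∣ ∣ⁿ_) (sym (∣f∣≡ t)) (n∣m*n ∣ φ ∣)

  ∣f∣>0 : ∀ k → 0 < ∣ f β k ∣
  ∣f∣>0 k = n≢0⇒n>0 λ ∣f∣≡0 → f≢0 nonsq k (ℤP.∣i∣≡0⇒i≡0 ∣f∣≡0)

  H>0 : ∀ t → 0 < ∣ H t ∣
  H>0 t = n≢0⇒n>0 λ H≡0 → >⇒≢ (∣f∣>0 (d + m * t)) (trans (∣f∣≡ t) (trans (cong (∣ φ ∣ *_) H≡0) (*-zeroʳ ∣ φ ∣)))

  H-coprime-w : ∀ {p} t → Prime p → p ∣ⁿ ∣ H t ∣ → ¬ (p ∣ⁿ ∣ w ∣)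
  H-coprime-w {p} t pp p∣H p∣w = prime∤1 pp (subst (λ z → p ∣ⁿ ∣ z ∣) (cancel (w ℤ.* + t ℤ.* v))
    (∣ᵤ-- p (H t) (w ℤ.* + t ℤ.* v) p∣H (subst (p ∣ⁿ_) (sym (trans (ℤP.abs-* (w ℤ.* + t) v) (cong (_* ∣ v ∣) (ℤP.abs-* w (+ t)))))
      (∣m⇒∣m*n ∣ v ∣ (∣m⇒∣m*n t p∣w)))))
    where
    v : ℤ
    v = + 2 ℤ.* + d ℤ.+ + m ℤ.* + t
    cancel : ∀ z → (+ 1 ℤ.+ z) ℤ.- z ≡ + 1
    cancel = solveℤ

  ∣w∣≡ : ∣ w ∣ ≡ 2 * c * (∣ β ∣ * ∣ β ∣) * ∣ φ ∣
  ∣w∣≡ = trans (ℤP.abs-* (+ (2 * c) ℤ.* (β ℤ.* β)) φ)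
    (cong (_* ∣ φ ∣) (trans (ℤP.abs-* (+ (2 * c)) (β ℤ.* β)) (cong (2 * c *_) (ℤP.abs-* β β))))

  H-coprime : ∀ {p} t → Prime p → p ∣ⁿ ∣ H t ∣ → ¬ (p ∣ⁿ 2) × ¬ (p ∣ⁿ ∣ β ∣) × ¬ (p ∣ⁿ m)
  H-coprime {p} t pp p∣H = (λ p∣2 → avoid (∣m⇒∣m*n ∣ φ ∣ (∣m⇒∣m*n (∣ β ∣ * ∣ β ∣) (∣m⇒∣m*n c p∣2))))
    , (λ p∣β → avoid (∣m⇒∣m*n ∣ φ ∣ (∣n⇒∣m*n (2 * c) (∣m⇒∣m*n ∣ β ∣ p∣β))))
    , λ p∣m → [ (λ p∣2cβ² → avoid (∣m⇒∣m*n ∣ φ ∣ p∣2cβ²))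
              , (λ p∣φ² → [ p∤φ , p∤φ ]′ (euclidsLemma ∣ φ ∣ ∣ φ ∣ pp p∣φ²)) ]′
              (euclidsLemma (2 * c * (∣ β ∣ * ∣ β ∣)) (∣ φ ∣ * ∣ φ ∣) pp p∣m)
    where
    avoid : ¬ (p ∣ⁿ 2 * c * (∣ β ∣ * ∣ β ∣) * ∣ φ ∣)
    avoid d = H-coprime-w t pp p∣H (subst (p ∣ⁿ_) (sym ∣w∣≡) d)
    p∤φ : ¬ (p ∣ⁿ ∣ φ ∣)
    p∤φ p∣φ = avoid (∣n⇒∣m*n (2 * c * (∣ β ∣ * ∣ β ∣)) p∣φ)

  ∣β∣>0 : 0 < ∣ β ∣
  ∣β∣>0 = n≢0⇒n>0 λ ∣β∣≡0 → nonsq (+ 0 , sym (cong -_ (ℤP.∣i∣≡0⇒i≡0 ∣β∣≡0)))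

  2cβ²>0 : 0 < 2 * c * (∣ β ∣ * ∣ β ∣)
  2cβ²>0 = m*n>0 {2 * c} (m*n>0 {2} z<s c>0) (m*n>0 ∣β∣>0 ∣β∣>0)

  m>0 : 0 < m
  m>0 = m*n>0 2cβ²>0 (m*n>0 (∣f∣>0 d) (∣f∣>0 d))

  c∣m : c ∣ⁿ m
  c∣m = ∣m⇒∣m*n (∣ φ ∣ * ∣ φ ∣) (∣m⇒∣m*n (∣ β ∣ * ∣ β ∣) (n∣m*n 2))

  ∣φ∣≤m : ∣ φ ∣ ≤ m
  ∣φ∣≤m = nonzero-factor≤ m>0 (∣n⇒∣m*n (2 * c * (∣ β ∣ * ∣ β ∣)) (m∣m*n ∣ φ ∣))

  ∣β∣≤m : ∣ β ∣ ≤ m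
  ∣β∣≤m = nonzero-factor≤ m>0 (∣m⇒∣m*n (∣ φ ∣ * ∣ φ ∣) (∣n⇒∣m*n (2 * c) (m∣m*n ∣ β ∣)))

  -- With k = d + m t, k² ≥ 4 m² S² outweighs ∣φ∣ S² + ∣β∣, because ∣φ∣ and ∣β∣ are both at most m.
  H≥ : ∀ {S} t → 0 < S → 2 * m * S ≤ d + m * t → S * S ≤ ∣ H t ∣
  H≥ {S} t S>0 2mS≤k = *-cancelˡ-≤ ∣ φ ∣ {{>-nonZero (∣f∣>0 d)}} (+-cancelʳ-≤ ∣ β ∣ _ _ (begin
    ∣ φ ∣ * (S * S) + ∣ β ∣                  ≤⟨ +-mono-≤ (*-monoˡ-≤ (S * S) ∣φ∣≤m) (≤-trans ∣β∣≤m (m≤m*n m (S * S) {{>-nonZero (m*n>0 S>0 S>0)}})) ⟩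
    m * (S * S) + m * (S * S)                ≤⟨ m≤n*m _ (2 * m) {{>-nonZero (m*n>0 {2} z<s m>0)}} ⟩
    2 * m * (m * (S * S) + m * (S * S))      ≡⟨ arith m S ⟩
    2 * m * S * (2 * m * S)                  ≤⟨ *-mono-≤ 2mS≤k 2mS≤k ⟩
    (d + m * t) * (d + m * t)                ≤⟨ k²≤∣f∣+∣β∣ β (d + m * t) ⟩
    ∣ f β (d + m * t) ∣ + ∣ β ∣              ≡⟨ cong (_+ ∣ β ∣) (∣f∣≡ t) ⟩
    (∣ φ ∣ * ∣ H t ∣) + ∣ β ∣                ∎))
    where
    open ≤-Reasoning
    arith : ∀ m S → 2 * m * (m * (S * S) + m * (S * S)) ≡ 2 * m * S * (2 * m * S)
    arith = solveℕ

  -- The values are O(S²); a third factor S absorbs the constant, which costs only the exponent 3 in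
  -- `growth`.
  H≤ : ∀ {S K} t → 0 < S → d + m * t ≤ K * S → K * K + ∣ β ∣ ≤ S → ∣ H t ∣ ≤ S * S * S
  H≤ {S} {K} t S>0 k≤KS K²+∣β∣≤S = ≤-trans (nonzero-factor≤ (∣f∣>0 (d + m * t)) (H∣f t))
    (≤-trans (∣f∣≤ β (d + m * t)) (≤-trans (+-mono-≤ (*-mono-≤ k≤KS k≤KS) (m≤m*n ∣ β ∣ (S * S) {{>-nonZero (m*n>0 S>0 S>0)}}))
      (≤-trans (≤-reflexive (arith K S ∣ β ∣)) (≤-trans (*-monoˡ-≤ (S * S) K²+∣β∣≤S) (≤-reflexive (sym (*-assoc S S S)))))))
    where
    arith : ∀ K S b → K * S * (K * S) + b * (S * S) ≡ (K * K + b) * (S * S)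
    arith = solveℕ

-- From the subprogression back to F_n

f∣F : ∀ β {k} ks → k ∈ ks → ∣ f β k ∣ ∣ⁿ ∣ foldr (λ k acc → f β k ℤ.* acc) (+ 1) ks ∣
f∣F β (k ∷ ks) (here refl) = subst (∣ f β k ∣ ∣ⁿ_) (sym (ℤP.abs-* (f β k) (foldr _ (+ 1) ks))) (m∣m*n _)
f∣F β (k ∷ ks) (there k∈)  = subst (_ ∣ⁿ_) (sym (ℤP.abs-* (f β k) (foldr _ (+ 1) ks))) (∣n⇒∣m*n ∣ f β k ∣ (f∣F β ks k∈))

-- A prime factor of A is at most A, so a bounded search decides the matter. This lets the
-- refutation of smoothness yield an actual prime.
large-prime-factor? : ∀ A B → 0 < A → (∃ λ p → Prime p × B < p × p ∣ⁿ A) ⊎ (∀ p → Prime p → p ∣ⁿ A → p ≤ B)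
large-prime-factor? A B A>0 with anyUpTo? (λ p → prime? p ×-dec (B <? p) ×-dec (p ∣? A)) (suc A)
... | yes (p , _ , pp , B<p , p∣A) = inj₁ (p , pp , B<p , p∣A)
... | no none = inj₂ λ p pp p∣A → ≮⇒≥ λ B<p → none (p , s≤s (∣⇒≤ {{>-nonZero A>0}} p∣A) , pp , B<p , p∣A)

module LargePrime
  (β : ℤ) (nonsq : NonSquare (- β)) (c d : ℕ) (c>0 : 0 < c) (α D : ℕ) (α>0 : 0 < α) (D>0 : 0 < D) (M : ℕ)
  where

  open Progression β nonsq c d c>0

  instance
    D≢0 : NonZero D
    D≢0 = >-nonZero D>0
    m≢0 : NonZero m
    m≢0 = >-nonZero m>0
    Dm≢0 : NonZero (D * m)
    Dm≢0 = m*n≢0 D m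

  Conclusion : ℕ → Set
  Conclusion n = ∃ λ p → Prime p × p > M * n × ∃ λ k → α * n ≤ D * k × D * k ≤ suc α * n × d ≤ k × c ∣ⁿ k ∸ d × p ∣ⁿ ∣ f β k ∣

  large-prime : ∀ N n L .{{_ : NonZero N}} → let S = N * N ; K = suc α * L in
    2 * (D * m) * S ≤ n → n ≤ L * S → d ≤ S → K * K + ∣ β ∣ ≤ S → suc ∣ β ∣ * suc ∣ β ∣ < S → 24 * primeCount (M * n) ≤ S →
    Conclusion n
  large-prime N n L gS≤n n≤LS d≤S K²+∣β∣≤S b²<S few-primes =
    [ found , (λ smooth → ⊥-elim (¬smooth smooth)) ]′ (large-prime-factor? A (M * n) A>0)
    where
    open ≤-Reasoning
    S = N * N
    K = suc α * L
    b = suc ∣ β ∣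
    S>0 : 0 < S
    S>0 = m*n>0 (>-nonZero⁻¹ N) (>-nonZero⁻¹ N)
    open Window α D d m n S (m≤m*n D m) gS≤n d≤S
    k : ℕ → ℕ
    k s = d + m * (t₀ + s)
    h : ℕ → ℕ
    h s = ∣ H (t₀ + s) ∣
    A = ∏ S h
    h∣f : ∀ s → h s ∣ⁿ ∣ f β (d + m * t₀ + m * s) ∣
    h∣f s = subst (λ j → h s ∣ⁿ ∣ f β j ∣) (regroup d m t₀ s) (H∣f (t₀ + s))
      where
      regroup : ∀ d m t s → d + m * (t + s) ≡ d + m * t + m * s
      regroup = solveℕ
    -- Since α ≥ 1, the window stays at distance n / D from 0, even when a = 0; this gives the
    -- values of f their full size.
    k≥ : ∀ s → 2 * m * S ≤ k s
    k≥ s = *-cancelˡ-≤ D (begin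
      D * (2 * m * S)          ≡⟨ arith D m S ⟩
      2 * (D * m) * S          ≤⟨ gS≤n ⟩
      n                        ≤⟨ m≤n*m n α {{>-nonZero α>0}} ⟩
      α * n                    ≤⟨ term≥ s ⟩
      D * k s                  ∎)
      where
      arith : ∀ D m S → D * (2 * m * S) ≡ 2 * (D * m) * S
      arith = solveℕ
    k≤ : ∀ s → s < S → k s ≤ K * S
    k≤ s s<S = begin
      k s                      ≤⟨ m≤n*m (k s) D ⟩
      D * k s                  ≤⟨ term≤ s s<S ⟩
      suc α * n                ≤⟨ *-monoʳ-≤ (suc α) n≤LS ⟩
      suc α * (L * S)      ≡⟨ *-assoc (suc α) L S ⟨
      K * S                    ∎
    S²ˢ≤A : (S * S) ^ S ≤ A
    S²ˢ≤A = subst (_≤ A) (∏-const S (S * S)) (∏-mono S λ s _ → H≥ (t₀ + s) S>0 (k≥ s))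
    comparison : (∀ p → Prime p → p ∣ⁿ A → p ≤ M * n) →
      A ^ S ≤ ((b * S) ^ S) ^ S * ((S * S * S) ^ primeCount (M * n)) ^ (4 * S)
    comparison smooth = Comparison.comparison β nonsq N (d + m * t₀) m h (λ s → H>0 (t₀ + s)) h∣f (S * S * S)
      (λ s s<S → H≤ {S} {K} (t₀ + s) S>0 (k≤ s s<S) K²+∣β∣≤S) (λ s → H-coprime (t₀ + s)) (M * n) (λ {p} → smooth p)
    A>0 : 0 < A
    A>0 = ∏>0 S λ s _ → H>0 (t₀ + s)
    Smooth : Set
    Smooth = ∀ p → Prime p → p ∣ⁿ A → p ≤ M * n
    ¬smooth : ¬ Smooth
    ¬smooth smooth = <⇒≱ b²<S (growth b S A (primeCount (M * n)) S>0 S²ˢ≤A (comparison smooth) few-primes)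
    found : (∃ λ p → Prime p × M * n < p × p ∣ⁿ A) → Conclusion n
    found (p , pp , Mn<p , p∣A) = let s , s<S , p∣h = prime∣∏⇒∣factor pp S h p∣A in
      p , pp , Mn<p , k s , term≥ s , term≤ s s<S , m≤m+n d (m * (t₀ + s))
      , subst (c ∣ⁿ_) (sym (m+n∸m≡n d (m * (t₀ + s)))) (∣m⇒∣m*n (t₀ + s) c∣m)
      , ∣-trans p∣h (H∣f (t₀ + s))

  eventually-large-prime : ∃ λ B → ∀ n → n > B → Conclusion n
  eventually-large-prime = let B , scale = quadratic-scale g T (m*n>0 {2} z<s (m*n>0 D>0 m>0)) z<s in
    B , λ n n>B → let N , T≤N , gS≤n , n≤LS = scale n n>B in at-scale n N T≤N gS≤n n≤LS
    where
    g L K b S₀ T : ℕ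
    g = 2 * (D * m)
    L = 4 * g
    K = suc α * L
    b = suc ∣ β ∣
    S₀ = proj₁ (primeCount-sparse (M * L))
    -- The sum of all thresholds on S: b² to contradict `growth`, d for the window, K² + ∣β∣ for
    -- `H≤`, `S₀` for the sparsity of primes. N ≥ T suffices since S = N² ≥ N.
    T = suc (b * b) + (d + ((K * K + ∣ β ∣) + S₀))
    at-scale : ∀ n N → T ≤ N → g * (N * N) ≤ n → n ≤ L * (N * N) → Conclusion n
    at-scale n N T≤N gS≤n n≤LS = large-prime N n L gS≤n n≤LS
      (≤-trans (m≤m+n d _) rest≤S)
      (≤-trans (m≤m+n (K * K + ∣ β ∣) S₀) K²+∣β∣+S₀≤S)
      (≤-trans (m≤m+n (suc (b * b)) _) T≤S)
      (proj₂ (primeCount-sparse (M * L)) (N * N) (M * n) (≤-trans (m≤n+m S₀ (K * K + ∣ β ∣)) K²+∣β∣+S₀≤S)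
        (≤-trans (*-monoʳ-≤ M n≤LS) (≤-reflexive (sym (*-assoc M L (N * N))))))
      where
      instance
        N≢0 : NonZero N
        N≢0 = >-nonZero (≤-trans z<s T≤N)
      T≤S : T ≤ N * N
      T≤S = ≤-trans T≤N (m≤m*n N N)
      rest≤S : d + ((K * K + ∣ β ∣) + S₀) ≤ N * N
      rest≤S = ≤-trans (m≤n+m _ (suc (b * b))) T≤S
      K²+∣β∣+S₀≤S : (K * K + ∣ β ∣) + S₀ ≤ N * N
      K²+∣β∣+S₀≤S = ≤-trans (m≤n+m _ d) rest≤S

theorem3p3 : (β : ℤ) → ¬ (∃ λ (t : ℤ) → t ℤ.* t ≡ - β) →
    (a b : ℚ) → 0ℚ ℚ.≤ a → a ℚ.< b →
    (c d : ℕ) → 0 < c → (M : ℕ) →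
    Σ ℕ λ B → (n : ℕ) → n > B →
    Σ ℕ λ p → Prime p × (p > M * n) × ((+ p) ∣ F β a b c d n)
theorem3p3 β nonsq a b 0≤a a<b c d c>0 M =
  let α , D , α>0 , D>0 , window = rational-window a b 0≤a a<b
      B , large = LargePrime.eventually-large-prime β nonsq c d c>0 α D α>0 D>0 M
  in B , λ n n>B →
    let p , pp , p>Mn , k , αn≤Dk , Dk≤ , d≤k , c∣k-d , p∣f = large n n>B
        an≤k , k≤bn , k≤range = window n k αn≤Dk Dk≤
    in p , pp , p>Mn , ∣-trans p∣f (f∣F β (I a b c d n)
         (∈-filter⁺ (InI? a b c d n) (∈-upTo⁺ (s≤s k≤range)) (an≤k , k≤bn , d≤k , c∣k-d)))
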